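{- Let $f:\mathbb{R}\to\mathbb{R}$ be the $1$-periodic function with $f(x)=x-2^x$ for $x\in[0,1]$. There is a function $\varepsilon(n)\to 0$ (as $n\to\infty$) such that for all sufficiently large $n$ there is a tree $T$ with $n$ vertices satisfying $$\mu_T\ge n-2\log_2(0.9n)+f\big(2\log_2(0.9n)\big)-\varepsilon(n).$$
   Context: A subtree of a tree $T$ is a (nonempty) induced connected subgraph; the mean subtree order $\mu_T$ is the average number of vertices of a subtree of $T$, averaged over all subtrees. -}

module Defs where

open import Data.Nat as ℕ using (ℕ; zero; suc; _+_; _*_; _∸_)
open import Data.Bool using (Bool; true; false; _∧_; _∨_; if_then_else_)
open import Data.Fin using (Fin)
open import Data.Fin.Properties using (_≟_)
open import Data.List using (List; []; _∷_; map; concatMap; allFin; length; filter)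
open import Data.Bool.ListAction using (any; all)
open import Data.Nat.ListAction using (sum)
open import Data.Vec.Functional as VF using (Vector)
open import Data.Integer using (+_)
open import Data.Rational using (ℚ; _/_; 0ℚ)
open import Relation.Nullary.Decidable using (⌊_⌋)
open import Relation.Binary.PropositionalEquality using (_≡_)
open import Data.Product using (_×_)

Graph : ℕ → Set
Graph n = Fin n → Fin n → Bool

IsSimple : {n : ℕ} → Graph n → Set
IsSimple {n} G = (∀ i j → G i j ≡ G j i) × (∀ i → G i i ≡ false)

VSubset : ℕ → Set
VSubset n = Fin n → Bool

allSubsets : (n : ℕ) → List (VSubset n)
allSubsets zero = VF.[] ∷ []
allSubsets (suc n) = concatMap (λ s → (false VF.∷ s) ∷ (true VF.∷ s) ∷ []) (allSubsets n)

anyV : {n : ℕ} → (Fin n → Bool) → Bool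
anyV {n} p = any p (allFin n)

allV : {n : ℕ} → (Fin n → Bool) → Bool
allV {n} p = all p (allFin n)

_⇒b_ : Bool → Bool → Bool
false ⇒b _ = true
true ⇒b b = b

step : {n : ℕ} → Graph n → VSubset n → VSubset n → VSubset n
step G S R v = S v ∧ (R v ∨ anyV (λ u → R u ∧ G u v))

reach : {n : ℕ} → Graph n → VSubset n → ℕ → VSubset n → VSubset n
reach G S zero R = R
reach G S (suc k) R = step G S (reach G S k R)

singleton : {n : ℕ} → Fin n → VSubset n
singleton u v = ⌊ u ≟ v ⌋

connectedInduced : {n : ℕ} → Graph n → VSubset n → Bool
connectedInduced {n} G S =
  anyV S ∧ allV (λ u → S u ⇒b allV (λ v → S v ⇒b reach G S n (singleton u) v))

edgeCount : {n : ℕ} → Graph n → ℕ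
edgeCount {n} G =
  length (filter (λ p → Data.Bool._≟_ p true)
    (concatMap (λ i → map (λ j → ⌊ Data.Nat.Properties._<?_ (Data.Fin.toℕ i) (Data.Fin.toℕ j) ⌋ ∧ G i j) (allFin n)) (allFin n)))
  where
    import Data.Bool
    import Data.Nat.Properties
    import Data.Fin

IsTree : {n : ℕ} → Graph n → Set
IsTree {n} G = IsSimple G × (connectedInduced G (λ _ → true) ≡ true) × (edgeCount G ≡ n ∸ 1)

size : {n : ℕ} → VSubset n → ℕ
size {n} S = sum (map (λ v → if S v then 1 else 0) (allFin n))

subtrees : {n : ℕ} → Graph n → List (VSubset n)
subtrees {n} G = filter (λ S → Data.Bool._≟_ (connectedInduced G S) true) (allSubsets n)
  where import Data.Bool

-- a / b as a rational (b = 0 gives 0; never used with b = 0 below).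
divℕ : ℕ → ℕ → ℚ
divℕ a zero = 0ℚ
divℕ a (suc b) = (+ a) / suc b

meanSubtreeOrder : {n : ℕ} → Graph n → ℚ
meanSubtreeOrder G = divℕ (sum (map size (subtrees G))) (length (subtrees G))

ℕtoℚ : ℕ → ℚ
ℕtoℚ n = (+ n) / 1

{-# OPTIONS --safe #-}

-- Write s = k - 2 and take a caterpillar with s leaves at each end of a spine of about n vertices and
-- four more leaves at the fractions 1/9, 1/3, 2/3, 8/9 of the spine.  The 4^k subtrees containing the
-- whole spine miss k vertices on average.  There are 2^(s + i) subtrees reaching from one end of the
-- spine to a given point before the other end, where i is the number of middle leaves on the way; summing
-- the vertices they miss over all points and both ends gives (261 / 324) n² 2^k to leading order, and all
-- remaining subtrees together miss only O(n³) vertices, with n² of the order of 2^k.  As 261 / 324 < 0.81,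
-- the lower order terms are absorbed for large n, so that ε = 0 works.
module Submission where

open import Defs
open import Data.Nat using (ℕ; _*_; _^_; suc)
open import Data.Rational using (ℚ; _≤_; _<_; _-_; ∣_∣; 0ℚ)
open import Data.Product using (Σ; ∃; ∃-syntax; _×_)

open import Data.Bool using (Bool; true; false; _∧_; _∨_; if_then_else_; T; not)
import Data.Bool as Bool
open import Data.Bool.Properties using (∨-comm; ∨-zeroʳ; ∧-zeroʳ; ∧-identityʳ; ∨-identityʳ; T-≡)
open import Data.Empty using (⊥; ⊥-elim)
open import Data.Fin using (Fin; toℕ; fromℕ<) renaming (zero to fzero; suc to fsuc)
import Data.Fin.Properties as Fin
open import Data.Fin.Properties using (toℕ-fromℕ<; toℕ-injective; toℕ<n)
import Data.Integer as ℤ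
import Data.Integer.Properties as ℤ
open import Data.List using (List; []; _∷_; map; concatMap; filter; length; tabulate; allFin)
open import Data.List.Properties using (map-tabulate; map-++; map-∘)
import Data.List.Relation.Unary.All.Properties as All
import Data.List.Relation.Unary.Any.Properties as Any
import Data.Nat as ℕ
open import Data.Nat using (zero; pred; _+_; _∸_; z≤n; s≤s; s≤s⁻¹; z<s; _≤ᵇ_; _<ᵇ_; _≡ᵇ_)
open import Data.Nat.DivMod using (m≡m%n+[m/n]*n; m%n<n)
open import Data.Nat.ListAction using (sum)
open import Data.Nat.ListAction.Properties using (sum-++)
open import Data.Nat.Properties
open import Data.Nat.Tactic.RingSolver using (solve-∀)
open import Data.Product using (_,_; proj₁; proj₂)
import Data.Rational as ℚ
import Data.Rational.Properties as ℚ
import Data.Rational.Unnormalised as ℚᵘ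
import Data.Rational.Unnormalised.Properties as ℚᵘ
open import Data.Sum using (_⊎_; inj₁; inj₂)
import Data.Vec.Functional as VF
open import Function using (_∘_; id; Equivalence)
open import Relation.Binary.PropositionalEquality
open import Relation.Nullary using (¬_; yes; no; contradiction)
open import Relation.Nullary.Decidable using (⌊_⌋)

-- Finite sums and products

-- For x = 2 log₂(0.9 n) with integer part k, the target n - x + f(x) equals n - k - 0.81 n² / 2^k.
-- This removes logarithms and reals: k is pinned down by 100 * 2^k ≤ 81 n² < 100 * 2^(k+1), and
-- everything can be cleared to an inequality between natural numbers. With 2k leaves the subtrees
-- containing the spine already account for the loss k. If k leaves sat at each end, the subtrees
-- anchored at just one end would lose a further n² / 2^k, with constant 1 in place of 0.81. Moving
-- two leaves from each end into the interior makes subtrees that stop early less numerous, and this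
-- gains the needed factor. The mean is n minus the average number of missing vertices, so an upper
-- bound on the total of missing vertices and a lower bound on the number of subtrees suffice. Hence
-- families of subtrees may overlap or be overcounted in the first bound, and the second may ignore
-- all subtrees that do not contain the spine. Only the spine-containing family needs its average
-- exactly.

𝟙 : Bool → ℕ
𝟙 b = if b then 1 else 0

∑ : ℕ → (ℕ → ℕ) → ℕ
∑ zero    f = 0
∑ (suc n) f = f 0 + ∑ n (f ∘ suc)

∏ : ℕ → (ℕ → ℕ) → ℕ
∏ zero    f = 1
∏ (suc n) f = f 0 * ∏ n (f ∘ suc)

∑-mono : ∀ n {f g} → (∀ i → i ℕ.< n → f i ℕ.≤ g i) → ∑ n f ℕ.≤ ∑ n g
∑-mono zero    h = z≤n
∑-mono (suc n) h = +-mono-≤ (h 0 z<s) (∑-mono n λ i i<n → h (suc i) (s≤s i<n))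

∑-cong : ∀ n {f g} → (∀ i → i ℕ.< n → f i ≡ g i) → ∑ n f ≡ ∑ n g
∑-cong zero    h = refl
∑-cong (suc n) h = cong₂ _+_ (h 0 z<s) (∑-cong n λ i i<n → h (suc i) (s≤s i<n))

∑-const : ∀ n c → ∑ n (λ _ → c) ≡ n * c
∑-const zero    c = refl
∑-const (suc n) c = cong (c +_) (∑-const n c)

∑-zero : ∀ n {f} → (∀ i → i ℕ.< n → f i ≡ 0) → ∑ n f ≡ 0
∑-zero n h = trans (∑-cong n h) (trans (∑-const n 0) (*-zeroʳ n))

∑-+ : ∀ n f g → ∑ n (λ i → f i + g i) ≡ ∑ n f + ∑ n g
∑-+ zero    f g = refl
∑-+ (suc n) f g = trans (cong (f 0 + g 0 +_) (∑-+ n (f ∘ suc) (g ∘ suc)))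
  (lem (f 0) (g 0) (∑ n (f ∘ suc)) (∑ n (g ∘ suc)))
  where
  lem : ∀ a b c d → a + b + (c + d) ≡ a + c + (b + d)
  lem = solve-∀

∑-*ˡ : ∀ n c f → ∑ n (λ i → c * f i) ≡ c * ∑ n f
∑-*ˡ zero    c f = sym (*-zeroʳ c)
∑-*ˡ (suc n) c f = trans (cong (c * f 0 +_) (∑-*ˡ n c (f ∘ suc))) (sym (*-distribˡ-+ c (f 0) _))

∑-split : ∀ a b f → ∑ (a + b) f ≡ ∑ a f + ∑ b (λ i → f (a + i))
∑-split zero    b f = refl
∑-split (suc a) b f = trans (cong (f 0 +_) (∑-split a b (f ∘ suc))) (sym (+-assoc (f 0) _ _))

∏-split : ∀ a b f → ∏ (a + b) f ≡ ∏ a f * ∏ b (λ i → f (a + i))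
∏-split zero    b f = sym (+-identityʳ _)
∏-split (suc a) b f = trans (cong (f 0 *_) (∏-split a b (f ∘ suc))) (sym (*-assoc (f 0) _ _))

∏-cong : ∀ n {f g} → (∀ i → i ℕ.< n → f i ≡ g i) → ∏ n f ≡ ∏ n g
∏-cong zero    h = refl
∏-cong (suc n) h = cong₂ _*_ (h 0 z<s) (∏-cong n λ i i<n → h (suc i) (s≤s i<n))

∏-one : ∀ n {f} → (∀ i → i ℕ.< n → f i ≡ 1) → ∏ n f ≡ 1
∏-one zero    h = refl
∏-one (suc n) {f} h = trans (cong (_* ∏ n (f ∘ suc)) (h 0 z<s))
  (trans (*-identityˡ _) (∏-one n λ i i<n → h (suc i) (s≤s i<n)))

∏-two : ∀ n → ∏ n (λ _ → 2) ≡ 2 ^ n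
∏-two zero    = refl
∏-two (suc n) = cong (2 *_) (∏-two n)

∑-swap : ∀ a b (f : ℕ → ℕ → ℕ) → ∑ a (λ i → ∑ b (f i)) ≡ ∑ b (λ j → ∑ a (λ i → f i j))
∑-swap zero    b f = sym (∑-zero b λ _ _ → refl)
∑-swap (suc a) b f = trans (cong (∑ b (f 0) +_) (∑-swap a b (f ∘ suc))) (sym (∑-+ b _ _))

∑-term : ∀ n f i → i ℕ.< n → f i ℕ.≤ ∑ n f
∑-term (suc n) f zero    _         = m≤m+n _ _
∑-term (suc n) f (suc i) (s≤s i<n) = ≤-trans (∑-term n (f ∘ suc) i i<n) (m≤n+m _ _)

∑-indicator : ∀ n x → x ℕ.< n → ∑ n (λ i → 𝟙 (i ≡ᵇ x)) ≡ 1
∑-indicator (suc n) zero    _         = cong suc (∑-zero n λ _ _ → refl)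
∑-indicator (suc n) (suc x) (s≤s x<n) = ∑-indicator n x x<n

∑-allFin : ∀ n (f : ℕ → ℕ) → sum (map (f ∘ toℕ) (allFin n)) ≡ ∑ n f
∑-allFin n f = trans (cong sum (map-tabulate {n = n} id (f ∘ toℕ))) (go n f)
  where
  go : ∀ n (f : ℕ → ℕ) → sum (tabulate {n = n} (f ∘ toℕ)) ≡ ∑ n f
  go zero    f = refl
  go (suc n) f = cong (f 0 +_) (go n (f ∘ suc))

-- Sums over all vertex sets

-- Following `allSubsets`, `F` is always applied to an explicit cons, on which functions recursive
-- in the first vertex compute. Sums over sets thus factor vertex by vertex without function
-- extensionality.
∑ˢ : ∀ n → (VSubset n → ℕ) → ℕ
∑ˢ zero    F = F VF.[]
∑ˢ (suc n) F = ∑ˢ n λ S → F (false VF.∷ S) + F (true VF.∷ S)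

∑ˢ-allSubsets : ∀ n F → sum (map F (allSubsets n)) ≡ ∑ˢ n F
∑ˢ-allSubsets zero    F = +-identityʳ _
∑ˢ-allSubsets (suc n) F = trans (go (allSubsets n)) (∑ˢ-allSubsets n _)
  where
  go : ∀ Ss → sum (map F (concatMap (λ s → (false VF.∷ s) ∷ (true VF.∷ s) ∷ []) Ss))
            ≡ sum (map (λ S → F (false VF.∷ S) + F (true VF.∷ S)) Ss)
  go []       = refl
  go (S ∷ Ss) = trans (cong (λ z → F (false VF.∷ S) + (F (true VF.∷ S) + z)) (go Ss))
                      (sym (+-assoc (F (false VF.∷ S)) _ _))

∑ˢ-mono : ∀ n {F G : VSubset n → ℕ} → (∀ S → F S ℕ.≤ G S) → ∑ˢ n F ℕ.≤ ∑ˢ n G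
∑ˢ-mono zero    h = h _
∑ˢ-mono (suc n) h = ∑ˢ-mono n λ S → +-mono-≤ (h _) (h _)

∑ˢ-cong : ∀ n {F G : VSubset n → ℕ} → (∀ S → F S ≡ G S) → ∑ˢ n F ≡ ∑ˢ n G
∑ˢ-cong zero    h = h _
∑ˢ-cong (suc n) h = ∑ˢ-cong n λ S → cong₂ _+_ (h _) (h _)

∑ˢ-+ : ∀ n (F G : VSubset n → ℕ) → ∑ˢ n (λ S → F S + G S) ≡ ∑ˢ n F + ∑ˢ n G
∑ˢ-+ zero    F G = refl
∑ˢ-+ (suc n) F G = trans (∑ˢ-cong n λ S → lem (F (false VF.∷ S)) _ _ _) (∑ˢ-+ n _ _)
  where
  lem : ∀ a b c d → a + b + (c + d) ≡ a + c + (b + d)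
  lem = solve-∀

∑ˢ-0 : ∀ n → ∑ˢ n (λ _ → 0) ≡ 0
∑ˢ-0 zero    = refl
∑ˢ-0 (suc n) = ∑ˢ-0 n

∑ˢ-*ˡ : ∀ n c (F : VSubset n → ℕ) → ∑ˢ n (λ S → c * F S) ≡ c * ∑ˢ n F
∑ˢ-*ˡ zero    c F = refl
∑ˢ-*ˡ (suc n) c F = trans (∑ˢ-cong n λ S → sym (*-distribˡ-+ c _ _)) (∑ˢ-*ˡ n c _)

∑ˢ-∑ : ∀ n k (F : ℕ → VSubset n → ℕ) →
       ∑ˢ n (λ S → ∑ k (λ i → F i S)) ≡ ∑ k (λ i → ∑ˢ n (F i))
∑ˢ-∑ n zero    F = ∑ˢ-0 n
∑ˢ-∑ n (suc k) F = trans (∑ˢ-+ n _ _) (cong (∑ˢ n (F 0) +_) (∑ˢ-∑ n k (F ∘ suc)))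

missing : ∀ {n} → VSubset n → ℕ
missing {zero}  S = 0
missing {suc n} S = (if S fzero then 0 else 1) + missing (S ∘ fsuc)

size-suc : ∀ {n} (S : VSubset (suc n)) → size S ≡ 𝟙 (S fzero) + size (S ∘ fsuc)
size-suc {n} S = cong (𝟙 (S fzero) +_) (cong sum
  (trans (map-tabulate {n = n} fsuc (λ v → 𝟙 (S v))) (sym (map-tabulate {n = n} id (λ v → 𝟙 (S (fsuc v)))))))

missing+size : ∀ {n} (S : VSubset n) → missing S + size S ≡ n
missing+size {zero}  S = refl
missing+size {suc n} S = trans (cong (missing S +_) (size-suc S)) (lem (S fzero) (missing+size (S ∘ fsuc)))
  where
  lem : ∀ b {x y} → x + y ≡ n → ((if b then 0 else 1) + x) + (𝟙 b + y) ≡ suc n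
  lem true  {x} {y} e = trans (+-suc x y) (cong suc e)
  lem false         e = cong suc e

-- Families of vertex sets prescribed vertex by vertex

data Constraint : Set where
  required forbidden free : Constraint

admits : Constraint → Bool → ℕ
admits required  b = 𝟙 b
admits forbidden b = if b then 0 else 1
admits free      _ = 1

choices : Constraint → ℕ
choices free = 2
choices _    = 1

-- A forbidden vertex is certainly missing and a free one possibly, so both are charged.
optional : Constraint → ℕ
optional required = 0
optional _        = 1

-- The indicator of a family is a product over the vertices, so its sum over all sets is the product
-- of the `choices`.
matches : ∀ {n} → (ℕ → Constraint) → VSubset n → ℕ
matches {zero}  q S = 1
matches {suc n} q S = admits (q 0) (S fzero) * matches (q ∘ suc) (S ∘ fsuc)

matches-intro : ∀ {n} q (S : VSubset n) → (∀ u → admits (q (toℕ u)) (S u) ≡ 1) → matches q S ≡ 1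
matches-intro {zero}  q S h = refl
matches-intro {suc n} q S h = cong₂ _*_ (h fzero) (matches-intro (q ∘ suc) (S ∘ fsuc) (h ∘ fsuc))

admits-01 : ∀ c b → admits c b ≡ 0 ⊎ admits c b ≡ 1
admits-01 required  true  = inj₂ refl
admits-01 required  false = inj₁ refl
admits-01 forbidden true  = inj₁ refl
admits-01 forbidden false = inj₂ refl
admits-01 free      b     = inj₂ refl

matches-elim : ∀ {n} q (S : VSubset n) →
               matches q S ≡ 0 ⊎ (matches q S ≡ 1 × (∀ u → admits (q (toℕ u)) (S u) ≡ 1))
matches-elim {zero}  q S = inj₂ (refl , λ ())
matches-elim {suc n} q S with admits-01 (q 0) (S fzero) | matches-elim (q ∘ suc) (S ∘ fsuc)
... | inj₁ e | _            = inj₁ (cong (_* matches (q ∘ suc) (S ∘ fsuc)) e)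
... | inj₂ e | inj₁ e′      = inj₁ (trans (cong₂ _*_ e e′) refl)
... | inj₂ e | inj₂ (e′ , h) = inj₂ (cong₂ _*_ e e′ , λ { fzero → e ; (fsuc u) → h u })

missing≤ : ∀ {n} q (S : VSubset n) → (∀ u → admits (q (toℕ u)) (S u) ≡ 1) →
           missing S ℕ.≤ ∑ n (optional ∘ q)
missing≤ {zero}  q S h = z≤n
missing≤ {suc n} q S h = +-mono-≤ (lem (q 0) (S fzero) (h fzero)) (missing≤ (q ∘ suc) (S ∘ fsuc) (h ∘ fsuc))
  where
  lem : ∀ c b → admits c b ≡ 1 → (if b then 0 else 1) ℕ.≤ optional c
  lem _         true  _ = z≤n
  lem forbidden false _ = ≤-refl
  lem free      false _ = ≤-refl

∑ˢ-matches : ∀ n q → ∑ˢ n (matches q) ≡ ∏ n (choices ∘ q)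
∑ˢ-matches zero    q = refl
∑ˢ-matches (suc n) q = trans (∑ˢ-cong n λ S → lem (q 0) (matches (q ∘ suc) S))
  (trans (∑ˢ-*ˡ n (choices (q 0)) _) (cong (choices (q 0) *_) (∑ˢ-matches n (q ∘ suc))))
  where
  lem : ∀ c x → admits c false * x + admits c true * x ≡ choices c * x
  lem required  x = refl
  lem forbidden x = +-identityʳ _
  lem free      x = cong (_+ (x + 0)) (+-identityʳ x)

-- Free vertices are charged as always missing, which wastes half a vertex for each of them. For
-- families that miss part of the spine this is of lower order.
∑ˢ-matches-missing : ∀ n q → ∑ˢ n (λ S → matches q S * missing S)
                     ℕ.≤ ∑ n (optional ∘ q) * ∏ n (choices ∘ q)
∑ˢ-matches-missing n q = ≤-trans (∑ˢ-mono n pt)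
  (≤-reflexive (trans (∑ˢ-*ˡ n (∑ n (optional ∘ q)) (matches q)) (cong (∑ n (optional ∘ q) *_) (∑ˢ-matches n q))))
  where
  pt : ∀ S → matches q S * missing S ℕ.≤ ∑ n (optional ∘ q) * matches q S
  pt S with matches-elim q S
  ... | inj₁ e rewrite e = z≤n
  ... | inj₂ (e , h) rewrite e | *-identityʳ (∑ n (optional ∘ q)) | +-identityʳ (missing S) = missing≤ q S h

-- Half of the free vertices are missing on average.
∑ˢ-matches-missing-exact : ∀ n q → (∀ i → i ℕ.< n → q i ≢ forbidden) →
  2 * ∑ˢ n (λ S → matches q S * missing S) ≡ ∑ n (optional ∘ q) * ∏ n (choices ∘ q)
∑ˢ-matches-missing-exact zero    q h = refl
∑ˢ-matches-missing-exact (suc n) q h = go (q 0) refl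
  where
  open ≡-Reasoning
  q′ = q ∘ suc
  X = ∑ˢ n (λ S → matches q′ S * missing S)
  O = ∑ n (optional ∘ q′)
  C = ∏ n (choices ∘ q′)
  ih : 2 * X ≡ O * C
  ih = ∑ˢ-matches-missing-exact n q′ λ i i<n → h (suc i) (s≤s i<n)
  a-lem : ∀ x y → 1 * x * (1 + y) + 1 * x * y ≡ 2 * (x * y) + x
  a-lem = solve-∀
  b-lem : ∀ O C → 2 * (O * C) + 2 * C ≡ (1 + O) * (2 * C)
  b-lem = solve-∀
  c-lem : ∀ X C → 2 * (2 * X + C) ≡ 2 * (2 * X) + 2 * C
  c-lem = solve-∀
  go : ∀ c → q 0 ≡ c → 2 * ∑ˢ n (λ S → admits c false * matches q′ S * (1 + missing S) + admits c true * matches q′ S * missing S)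
       ≡ (optional c + O) * (choices c * C)
  go required  _ = trans (cong (2 *_) (∑ˢ-cong n λ S → cong (_* missing S) (*-identityˡ (matches q′ S))))
                     (trans ih (cong (O *_) (sym (*-identityˡ C))))
  go forbidden e = ⊥-elim (h 0 z<s e)
  go free      _ = begin
    2 * ∑ˢ n (λ S → 1 * matches q′ S * (1 + missing S) + 1 * matches q′ S * missing S)
      ≡⟨ cong (2 *_) (∑ˢ-cong n λ S → a-lem (matches q′ S) (missing S)) ⟩
    2 * ∑ˢ n (λ S → 2 * (matches q′ S * missing S) + matches q′ S)
      ≡⟨ cong (2 *_) (∑ˢ-+ n _ _) ⟩
    2 * (∑ˢ n (λ S → 2 * (matches q′ S * missing S)) + ∑ˢ n (matches q′))
      ≡⟨ cong (2 *_) (cong₂ _+_ (∑ˢ-*ˡ n 2 _) (∑ˢ-matches n q′)) ⟩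
    2 * (2 * X + C)       ≡⟨ c-lem X C ⟩
    2 * (2 * X) + 2 * C   ≡⟨ cong (λ z → 2 * z + 2 * C) ih ⟩
    2 * (O * C) + 2 * C   ≡⟨ b-lem O C ⟩
    (1 + O) * (2 * C)     ∎

-- Connected vertex sets, and graphs given by a parent function

T⇒≡ : ∀ {b} → T b → b ≡ true
T⇒≡ = Equivalence.to T-≡

≡⇒T : ∀ {b} → b ≡ true → T b
≡⇒T = Equivalence.from T-≡

¬T⇒≡ : ∀ {b} → ¬ T b → b ≡ false
¬T⇒≡ {true}  h = ⊥-elim (h _)
¬T⇒≡ {false} h = refl

∧-true : ∀ {a b} → a ∧ b ≡ true → a ≡ true × b ≡ true
∧-true {true} {true} _ = refl , refl

∨-true : ∀ {a b} → a ∨ b ≡ true → a ≡ true ⊎ b ≡ true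
∨-true {true}  _ = inj₁ refl
∨-true {false} e = inj₂ e

anyV-intro : ∀ {n} {p : Fin n → Bool} i → p i ≡ true → anyV p ≡ true
anyV-intro {p = p} i e = T⇒≡ (Any.any⁺ p (Any.tabulate⁺ i (≡⇒T e)))

anyV-elim : ∀ {n} {p : Fin n → Bool} → anyV p ≡ true → ∃[ i ] p i ≡ true
anyV-elim {p = p} e with Any.tabulate⁻ (Any.any⁻ p (allFin _) (≡⇒T e))
... | i , t = i , T⇒≡ t

allV-intro : ∀ {n} {p : Fin n → Bool} → (∀ i → p i ≡ true) → allV p ≡ true
allV-intro {p = p} h = T⇒≡ (All.all⁻ p (All.tabulate⁺ (λ i → ≡⇒T (h i))))

allV-elim : ∀ {n} {p : Fin n → Bool} → allV p ≡ true → ∀ i → p i ≡ true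
allV-elim {p = p} e i = T⇒≡ (All.tabulate⁻ (All.all⁺ p (allFin _) (≡⇒T e)) i)

⇒b-intro : ∀ {a b} → (a ≡ true → b ≡ true) → (a ⇒b b) ≡ true
⇒b-intro {true}  h = h refl
⇒b-intro {false} h = refl

⇒b-elim : ∀ {a b} → (a ⇒b b) ≡ true → a ≡ true → b ≡ true
⇒b-elim e refl = e

module _ {n} (G : Graph n) (S : VSubset n) where

  connected-intro : (∃[ u ] S u ≡ true) →
    (∀ u v → S u ≡ true → S v ≡ true → reach G S n (singleton u) v ≡ true) → connectedInduced G S ≡ true
  connected-intro (u , Su) h rewrite anyV-intro {p = S} u Su =
    allV-intro λ u → ⇒b-intro λ Su → allV-intro λ v → ⇒b-intro λ Sv → h u v Su Sv

  connected-elim : connectedInduced G S ≡ true → (∃[ u ] S u ≡ true) ×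
    (∀ u v → S u ≡ true → S v ≡ true → reach G S n (singleton u) v ≡ true)
  connected-elim e with ∧-true {anyV S} e
  ... | a , b = anyV-elim a , λ u v Su Sv → ⇒b-elim (allV-elim (⇒b-elim (allV-elim b u) Su) v) Sv

  reach-mono : ∀ {R k j} → k ℕ.≤ j → ∀ v → S v ≡ true → reach G S k R v ≡ true → reach G S j R v ≡ true
  reach-mono {R} k≤j v Sv e = go (≤⇒≤′ k≤j)
    where
    go : ∀ {j} → _ ℕ.≤′ j → reach G S j R v ≡ true
    go ℕ.≤′-refl       = e
    go (ℕ.≤′-step k≤j) rewrite Sv | go k≤j = refl

  reach-edge : ∀ {R k} u v → reach G S k R u ≡ true → G u v ≡ true → S v ≡ true →
               reach G S (suc k) R v ≡ true
  reach-edge {R} {k} u v Ru Guv Sv rewrite Sv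
    | anyV-intro {p = λ u → reach G S k R u ∧ G u v} u (cong₂ _∧_ Ru Guv) = ∨-zeroʳ (reach G S k R v)

  -- Each round adds only vertices of `S` adjacent to vertices already reached, so `W` is never
  -- left. Every necessary condition for connectedness below comes from a suitable choice of `W`.
  reach-closed : (W : Fin n → Set) → (∀ x y → W x → S y ≡ true → G x y ≡ true → W y) →
                 ∀ k u v → W u → reach G S k (singleton u) v ≡ true → W v
  reach-closed W cl zero u v Wu e with u Fin.≟ v
  ... | yes refl = Wu
  reach-closed W cl (suc k) u v Wu e with ∧-true {S v} e
  ... | Sv , e′ with ∨-true {reach G S k (singleton u) v} e′
  ...   | inj₁ r = reach-closed W cl k u v Wu r
  ...   | inj₂ a with anyV-elim a
  ...     | x , b with ∧-true {reach G S k (singleton u) x} b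
  ...       | r , g = cl x v (reach-closed W cl k u x Wu r) Sv g

singleton-refl : ∀ {n} (u : Fin n) → singleton u u ≡ true
singleton-refl u with u Fin.≟ u
... | yes _ = refl
... | no ¬p = contradiction refl ¬p

-- The test `x <ᵇ y` rules out loops whatever `par` is, in particular at a root that is its own
-- parent.
isParent : (ℕ → ℕ) → ℕ → ℕ → Bool
isParent par x y = (x <ᵇ y) ∧ (x ≡ᵇ par y)

adjacent : (ℕ → ℕ) → ℕ → ℕ → Bool
adjacent par x y = isParent par x y ∨ isParent par y x

parentGraph : ∀ n → (ℕ → ℕ) → Graph n
parentGraph n par u v = adjacent par (toℕ u) (toℕ v)

<ᵇ-irrefl : ∀ x → (x <ᵇ x) ≡ false
<ᵇ-irrefl zero    = refl
<ᵇ-irrefl (suc x) = <ᵇ-irrefl x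

parentGraph-simple : ∀ n par → IsSimple (parentGraph n par)
parentGraph-simple n par =
  (λ u v → ∨-comm (isParent par (toℕ u) (toℕ v)) _) ,
  (λ u → irr (toℕ u))
  where
  irr : ∀ x → adjacent par x x ≡ false
  irr x rewrite <ᵇ-irrefl x = refl

isParent-elim : ∀ par {x y} → isParent par x y ≡ true → x ℕ.< y × x ≡ par y
isParent-elim par {x} {y} e with ∧-true {x <ᵇ y} e
... | a , b = <ᵇ⇒< x y (≡⇒T a) , ≡ᵇ⇒≡ x (par y) (≡⇒T b)

isParent-intro : ∀ par {x y} → x ℕ.< y → x ≡ par y → isParent par x y ≡ true
isParent-intro par {x} {y} x<y e = cong₂ _∧_ (T⇒≡ (<⇒<ᵇ x<y)) (T⇒≡ (≡⇒≡ᵇ x (par y) e))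

adjacent-elim : ∀ par {x y} → adjacent par x y ≡ true → (x ℕ.< y × x ≡ par y) ⊎ (y ℕ.< x × y ≡ par x)
adjacent-elim par {x} {y} e with ∨-true {isParent par x y} e
... | inj₁ a = inj₁ (isParent-elim par a)
... | inj₂ a = inj₂ (isParent-elim par a)

adjacent-child : ∀ par {x y} → x ℕ.< y → x ≡ par y → adjacent par x y ≡ true
adjacent-child par x<y e rewrite isParent-intro par x<y e = refl

adjacent-parent : ∀ par {x y} → x ℕ.< y → x ≡ par y → adjacent par y x ≡ true
adjacent-parent par {x} {y} x<y e rewrite isParent-intro par x<y e = ∨-zeroʳ (isParent par y x)

length-filter : ∀ {A : Set} (c : A → Bool) xs →
                length (filter (λ x → c x Bool.≟ true) xs) ≡ sum (map (𝟙 ∘ c) xs)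
length-filter c []       = refl
length-filter c (x ∷ xs) with c x
... | true  = cong suc (length-filter c xs)
... | false = length-filter c xs

sum-concatMap : ∀ {A : Set} (g : A → List Bool) xs →
                sum (map 𝟙 (concatMap g xs)) ≡ sum (map (λ x → sum (map 𝟙 (g x))) xs)
sum-concatMap g []       = refl
sum-concatMap g (x ∷ xs) = trans (cong sum (map-++ 𝟙 (g x) (concatMap g xs)))
  (trans (sum-++ (map 𝟙 (g x)) _) (cong (sum (map 𝟙 (g x)) +_) (sum-concatMap g xs)))

edgeCount-ℕ : ∀ n (A : ℕ → ℕ → Bool) →
  edgeCount {n} (λ u v → A (toℕ u) (toℕ v)) ≡ ∑ n (λ i → ∑ n (λ j → 𝟙 (⌊ i <? j ⌋ ∧ A i j)))
edgeCount-ℕ n A = trans (length-filter id (concatMap row (allFin n)))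
  (trans (sum-concatMap row (allFin n)) (trans (cong sum (map-cong′ (allFin n)))
    (∑-allFin n λ i → ∑ n (λ j → 𝟙 (⌊ i <? j ⌋ ∧ A i j)))))
  where
  row : Fin n → List Bool
  row i = map (λ j → ⌊ toℕ i <? toℕ j ⌋ ∧ A (toℕ i) (toℕ j)) (allFin n)
  row-sum : ∀ i → sum (map 𝟙 (row i)) ≡ ∑ n (λ j → 𝟙 (⌊ toℕ i <? j ⌋ ∧ A (toℕ i) j))
  row-sum i = trans (cong sum (sym (map-∘ (allFin n)))) (∑-allFin n λ j → 𝟙 (⌊ toℕ i <? j ⌋ ∧ A (toℕ i) j))
  map-cong′ : ∀ is → map (λ i → sum (map 𝟙 (row i))) is
                   ≡ map (λ i → ∑ n (λ j → 𝟙 (⌊ toℕ i <? j ⌋ ∧ A (toℕ i) j))) is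
  map-cong′ []       = refl
  map-cong′ (i ∷ is) = cong₂ _∷_ (row-sum i) (map-cong′ is)

-- Edges are grouped by their larger endpoint: vertex 0 is the larger end of none, and every other
-- vertex of exactly one, the edge to its parent.
parentGraph-edgeCount : ∀ n par → (∀ y → par (suc y) ℕ.≤ y) → edgeCount (parentGraph n par) ≡ n ∸ 1
parentGraph-edgeCount zero    par h = refl
parentGraph-edgeCount (suc n) par h = begin
  edgeCount (parentGraph (suc n) par)   ≡⟨ edgeCount-ℕ (suc n) (adjacent par) ⟩
  ∑ (suc n) (λ i → ∑ (suc n) (F i))     ≡⟨ ∑-swap (suc n) (suc n) F ⟩
  ∑ (suc n) (λ i → F i 0) + ∑ n (λ j → ∑ (suc n) (λ i → F i (suc j)))
    ≡⟨ cong₂ _+_ (∑-zero (suc n) λ _ _ → refl) (∑-cong n {g = λ _ → 1} λ j j<n →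
         trans (∑-cong (suc n) λ i _ → one-parent i j)
               (∑-indicator (suc n) (par (suc j)) (s≤s (≤-trans (h j) (<⇒≤ j<n))))) ⟩
  ∑ n (λ _ → 1)                         ≡⟨ trans (∑-const n 1) (*-identityʳ n) ⟩
  n                                     ∎
  where
  open ≡-Reasoning
  F : ℕ → ℕ → ℕ
  F i j = 𝟙 (⌊ i <? j ⌋ ∧ adjacent par i j)
  one-parent : ∀ i j → F i (suc j) ≡ 𝟙 (i ≡ᵇ par (suc j))
  one-parent i j with i <? suc j
  ... | no i≮ rewrite ¬T⇒≡ {i ≡ᵇ par (suc j)} (λ t → i≮ (s≤s (subst (ℕ._≤ j) (sym (≡ᵇ⇒≡ i _ t)) (h j)))) = refl
  ... | yes i<sj rewrite T⇒≡ (<⇒<ᵇ i<sj)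
        | ¬T⇒≡ {suc j <ᵇ i} (λ t → <-asym i<sj (<ᵇ⇒< (suc j) i t)) = cong 𝟙 (∨-identityʳ _)

-- Subtrees of a caterpillar

≤ᵇ-true : ∀ {x y} → x ℕ.≤ y → (x ≤ᵇ y) ≡ true
≤ᵇ-true x≤y = T⇒≡ (≤⇒≤ᵇ x≤y)

≤ᵇ-false : ∀ {x y} → y ℕ.< x → (x ≤ᵇ y) ≡ false
≤ᵇ-false {x} {y} y<x = ¬T⇒≡ λ t → <⇒≱ y<x (≤ᵇ⇒≤ x y t)

true≢false : ∀ {b} → b ≡ true → b ≡ false → ⊥
true≢false refl ()

least : ∀ (f : ℕ → Bool) n → (∀ x → x ℕ.< n → f x ≡ false) ⊎
        (∃[ i ] (i ℕ.< n × f i ≡ true × (∀ x → x ℕ.< i → f x ≡ false)))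
least f zero = inj₁ λ _ ()
least f (suc n) with least f n
... | inj₂ (i , i<n , h) = inj₂ (i , m<n⇒m<1+n i<n , h)
... | inj₁ none with f n in fn
...   | true  = inj₂ (n , ≤-refl , fn , none)
...   | false = inj₁ λ x x<1+n → go x (m<1+n⇒m<n∨m≡n x<1+n)
  where
  go : ∀ x → x ℕ.< n ⊎ x ≡ n → f x ≡ false
  go x (inj₁ x<n)  = none x x<n
  go x (inj₂ refl) = fn

greatest : ∀ (f : ℕ → Bool) n → (∀ x → x ℕ.< n → f x ≡ false) ⊎
           (∃[ j ] (j ℕ.< n × f j ≡ true × (∀ x → j ℕ.< x → x ℕ.< n → f x ≡ false)))
greatest f zero = inj₁ λ _ ()
greatest f (suc n) with f n in fn
... | true = inj₂ (n , ≤-refl , fn , λ x n<x x<1+n → contradiction (s≤s⁻¹ x<1+n) (<⇒≱ n<x))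
... | false with greatest f n
...   | inj₁ none = inj₁ λ x x<1+n → go x (m<1+n⇒m<n∨m≡n x<1+n)
  where
  go : ∀ x → x ℕ.< n ⊎ x ≡ n → f x ≡ false
  go x (inj₁ x<n)  = none x x<n
  go x (inj₂ refl) = fn
...   | inj₂ (j , j<n , fj , h) = inj₂ (j , m<n⇒m<1+n j<n , fj , λ x j<x x<1+n → go x j<x (m<1+n⇒m<n∨m≡n x<1+n))
  where
  go : ∀ x → j ℕ.< x → x ℕ.< n ⊎ x ≡ n → f x ≡ false
  go x j<x (inj₁ x<n)  = h x j<x x<n
  go x j<x (inj₂ refl) = fn

inside : ℕ → ℕ → ℕ → Bool
inside i j x = (i ≤ᵇ x) ∧ (x ≤ᵇ j)

weight : Bool → ℕ
weight b = if b then 2 else 1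

-- The spine is the path on the labels from 0 to `m`; label `suc m + t` is a leaf hanging at spine
-- vertex `att t`. Numbering the leaves last makes every parent smaller than its child.
module Caterpillar (m M : ℕ) (att : ℕ → ℕ) (att≤m : ∀ t → att t ℕ.≤ m) where

  N : ℕ
  N = suc m + M

  -- `base` projects the tree onto its spine; it differs from `par` only on the spine.
  par base : ℕ → ℕ
  par  y = if y ≤ᵇ m then pred y else att (y ∸ suc m)
  base y = if y ≤ᵇ m then y      else att (y ∸ suc m)

  par-spine : ∀ {y} → y ℕ.≤ m → par y ≡ pred y
  par-spine h rewrite ≤ᵇ-true h = refl

  base-spine : ∀ {y} → y ℕ.≤ m → base y ≡ y
  base-spine h rewrite ≤ᵇ-true h = refl

  par-leaf : ∀ {y} → m ℕ.< y → par y ≡ base y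
  par-leaf h rewrite ≤ᵇ-false h = refl

  base≤m : ∀ y → base y ℕ.≤ m
  base≤m y with y ≤ᵇ m in e
  ... | true  = ≤ᵇ⇒≤ y m (≡⇒T e)
  ... | false = att≤m _

  par≤ : ∀ y → par (suc y) ℕ.≤ y
  par≤ y with suc y ≤? m
  ... | yes h = ≤-reflexive (par-spine h)
  ... | no h  = ≤-trans (≤-reflexive (par-leaf (≰⇒> h))) (≤-trans (base≤m (suc y)) (s≤s⁻¹ (≰⇒> h)))

  par≤m : ∀ y → par y ℕ.≤ m
  par≤m y with y ≤? m
  ... | yes h = ≤-trans (≤-reflexive (par-spine h)) (≤-trans pred[n]≤n h)
  ... | no h  = ≤-trans (≤-reflexive (par-leaf (≰⇒> h))) (base≤m y)

  caterpillar : Graph N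
  caterpillar = parentGraph N par

  module _ (S : VSubset N) where

    module _ (1≤M : 1 ℕ.≤ M) (spine : ∀ u → toℕ u ℕ.≤ m → S u ≡ true) (u : Fin N) where

      private
        R : ℕ → VSubset N
        R k = reach caterpillar S k (singleton u)
        b = base (toℕ u)

      reach-base : ∀ w → toℕ w ≡ b → R 1 w ≡ true
      reach-base w e with toℕ u ≤? m
      ... | yes h rewrite toℕ-injective {i = w} {j = u} (trans e (base-spine h)) =
              reach-mono caterpillar S {R = singleton u} {j = 1} z≤n u (spine u h) (singleton-refl u)
      ... | no h = reach-edge caterpillar S {R = singleton u} {k = 0} u w (singleton-refl u)
              (adjacent-parent par (≤-<-trans w≤m (≰⇒> h)) (trans e (sym (par-leaf (≰⇒> h)))))
              (spine w w≤m)
        where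
        w≤m : toℕ w ℕ.≤ m
        w≤m = ≤-trans (≤-reflexive e) (base≤m (toℕ u))

      reach-up : ∀ d w → toℕ w ≡ b + d → toℕ w ℕ.≤ m → R (suc d) w ≡ true
      reach-up zero    w e w≤m = reach-base w (trans e (+-identityʳ b))
      reach-up (suc d) w e w≤m = reach-edge caterpillar S {k = suc d} w′ w
          (reach-up d w′ e′ (≤-trans (<⇒≤ w′<w) w≤m))
          (adjacent-child par w′<w (trans (trans e′ (cong pred (sym e+))) (sym (par-spine w≤m)))) (spine w w≤m)
        where
        e+ : toℕ w ≡ suc (b + d)
        e+ = trans e (+-suc b d)
        x<w : b + d ℕ.< toℕ w
        x<w = ≤-reflexive (sym e+)
        x<N : b + d ℕ.< N
        x<N = <-trans x<w (toℕ<n w)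
        w′ = fromℕ< x<N
        e′ : toℕ w′ ≡ b + d
        e′ = toℕ-fromℕ< x<N
        w′<w : toℕ w′ ℕ.< toℕ w
        w′<w = ≤-<-trans (≤-reflexive e′) x<w

      reach-down : ∀ d w → toℕ w + d ≡ b → R (suc d) w ≡ true
      reach-down zero    w e = reach-base w (trans (sym (+-identityʳ _)) e)
      reach-down (suc d) w e = reach-edge caterpillar S {k = suc d} w′ w
          (reach-down d w′ (trans (cong (_+ d) e′) e+))
          (adjacent-parent par w<w′ (trans (cong pred (sym e′)) (sym (par-spine (≤-trans (≤-reflexive e′) x≤m)))))
          (spine w (≤-trans (n≤1+n _) x≤m))
        where
        e+ : suc (toℕ w) + d ≡ b
        e+ = trans (sym (+-suc (toℕ w) d)) e
        x≤m : suc (toℕ w) ℕ.≤ m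
        x≤m = ≤-trans (m≤m+n (suc (toℕ w)) d) (≤-trans (≤-reflexive e+) (base≤m (toℕ u)))
        x<N : suc (toℕ w) ℕ.< N
        x<N = s≤s (≤-trans x≤m (m≤m+n m M))
        w′ = fromℕ< x<N
        e′ : toℕ w′ ≡ suc (toℕ w)
        e′ = toℕ-fromℕ< x<N
        w<w′ : toℕ w ℕ.< toℕ w′
        w<w′ = ≤-reflexive (sym e′)

      reach-spine : ∀ w → toℕ w ℕ.≤ m → R (suc m) w ≡ true
      reach-spine w w≤m with ≤-total b (toℕ w)
      ... | inj₁ b≤w = reach-mono caterpillar S {j = suc m} (s≤s (≤-trans (m∸n≤m (toℕ w) b) w≤m)) w (spine w w≤m)
                         (reach-up (toℕ w ∸ b) w (sym (m+[n∸m]≡n b≤w)) w≤m)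
      ... | inj₂ w≤b = reach-mono caterpillar S {j = suc m} (s≤s (≤-trans (m∸n≤m b (toℕ w)) (base≤m (toℕ u)))) w (spine w w≤m)
                         (reach-down (b ∸ toℕ w) w (m+[n∸m]≡n w≤b))

      reach-all : ∀ v → S v ≡ true → R N v ≡ true
      reach-all v Sv with toℕ v ≤? m
      ... | yes h = reach-mono caterpillar S {j = N} (m≤m+n (suc m) M) v Sv (reach-spine v h)
      ... | no h  = reach-mono caterpillar S {k = suc (suc m)} {j = N} 2+m≤N v Sv
              (reach-edge caterpillar S {k = suc m} w v (reach-spine w w≤m)
                (adjacent-child par (≤-<-trans w≤m (≰⇒> h)) (trans e (sym (par-leaf (≰⇒> h))))) Sv)
        where
        x<N : base (toℕ v) ℕ.< N
        x<N = s≤s (≤-trans (base≤m (toℕ v)) (m≤m+n m M))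
        w = fromℕ< x<N
        e : toℕ w ≡ base (toℕ v)
        e = toℕ-fromℕ< x<N
        w≤m : toℕ w ℕ.≤ m
        w≤m = ≤-trans (≤-reflexive e) (base≤m (toℕ v))
        -- One round reaches the base of `u`, at most `m` more run along the spine, and a last one
        -- enters the leaf. The budget of `N` rounds covers this as soon as there is a leaf.
        2+m≤N : suc (suc m) ℕ.≤ N
        2+m≤N = ≤-trans (≤-reflexive (+-comm 1 (suc m))) (+-monoʳ-≤ (suc m) 1≤M)

    spine-connected : 1 ℕ.≤ M → (∀ u → toℕ u ℕ.≤ m → S u ≡ true) → connectedInduced caterpillar S ≡ true
    spine-connected 1≤M spine = connected-intro caterpillar S (fzero , spine fzero z≤n)
      λ u v _ Sv → reach-all 1≤M spine u v Sv

    module _ (conn : connectedInduced caterpillar S ≡ true) where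

      closed-invariant : (W : Fin N → Set) →
        (∀ x y → W x → S y ≡ true → caterpillar x y ≡ true → W y) →
        ∀ u v → S u ≡ true → S v ≡ true → W u → W v
      closed-invariant W cl u v Su Sv Wu =
        reach-closed caterpillar S W cl N u v Wu (proj₂ (connected-elim caterpillar S conn) u v Su Sv)

      -- A leaf is nobody's parent, so its base is its only neighbour; without the base, the leaf
      -- alone is closed under edges into `S`.
      lonely-leaf : ∀ u → S u ≡ true → m ℕ.< toℕ u → (∀ w → toℕ w ≡ base (toℕ u) → S w ≡ false) →
                    ∀ v → S v ≡ true → v ≡ u
      lonely-leaf u Su m<u h v Sv = closed-invariant (_≡ u) cl u v Su Sv refl
        where
        cl : ∀ x y → x ≡ u → S y ≡ true → caterpillar x y ≡ true → y ≡ u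
        cl x y refl Sy g with adjacent-elim par {toℕ u} {toℕ y} g
        ... | inj₁ (_ , e) = contradiction (≤-trans (≤-reflexive e) (par≤m (toℕ y))) (<⇒≱ m<u)
        ... | inj₂ (_ , e) = ⊥-elim (true≢false Sy (h y (trans e (par-leaf m<u))))

      -- An edge moves the base by at most one, and from the left the base `x` can be entered only
      -- at the vertex `x` itself. If that vertex is missing, the vertices with base left of `x` are
      -- closed under edges into `S`, and `v` would be among them.
      no-gap : ∀ u v x → S u ≡ true → S v ≡ true → toℕ u ℕ.≤ m → toℕ v ℕ.≤ m → toℕ u ℕ.< toℕ x → toℕ x ℕ.≤ toℕ v →
               S x ≡ true
      no-gap u v x Su Sv u≤m v≤m u<x x≤v with S x in Sx
      ... | true  = refl
      ... | false = contradiction v<x (≤⇒≯ x≤v)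
        where
        W : Fin N → Set
        W y = base (toℕ y) ℕ.< toℕ x
        up : ∀ y z → S z ≡ true → toℕ y ≡ par (toℕ z) → toℕ y ℕ.< toℕ z → W y → W z
        up y z Sz e y<z Wy with toℕ z ≤? m
        ... | no h  = subst (ℕ._< toℕ x) (trans (trans (base-spine (≤-trans (≤-reflexive e) (par≤m (toℕ z)))) e)
                                              (par-leaf (≰⇒> h))) Wy
        ... | yes h = subst (ℕ._< toℕ x) (sym (base-spine h)) (≤∧≢⇒< z≤x z≢x)
          where
          y<x : toℕ y ℕ.< toℕ x
          y<x = subst (ℕ._< toℕ x) (base-spine (≤-trans (≤-reflexive e) (par≤m (toℕ z)))) Wy
          z≤x : toℕ z ℕ.≤ toℕ x
          z≤x = ≤-trans (suc-pred-≤ (toℕ z)) (subst (λ t → suc t ℕ.≤ toℕ x) (trans e (par-spine h)) y<x)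
            where
            suc-pred-≤ : ∀ z → z ℕ.≤ suc (pred z)
            suc-pred-≤ zero    = z≤n
            suc-pred-≤ (suc z) = ≤-refl
          z≢x : toℕ z ≢ toℕ x
          z≢x e = true≢false (subst (λ t → S t ≡ true) (toℕ-injective e) Sz) Sx
        down : ∀ y z → toℕ y ≡ par (toℕ z) → toℕ y ℕ.< toℕ z → W z → W y
        down y z e y<z Wz = ≤-<-trans (≤-trans (≤-reflexive (base-spine (≤-trans (≤-reflexive e) (par≤m (toℕ z))))) y≤bz) Wz
          where
          y≤bz : toℕ y ℕ.≤ base (toℕ z)
          y≤bz with toℕ z ≤? m
          ... | yes h = ≤-trans (<⇒≤ y<z) (≤-reflexive (sym (base-spine h)))
          ... | no h  = ≤-reflexive (trans e (par-leaf (≰⇒> h)))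
        cl : ∀ y z → W y → S z ≡ true → caterpillar y z ≡ true → W z
        cl y z Wy Sz g with adjacent-elim par {toℕ y} {toℕ z} g
        ... | inj₁ (y<z , e) = up y z Sz e y<z Wy
        ... | inj₂ (z<y , e) = down z y e z<y Wy
        v<x : toℕ v ℕ.< toℕ x
        v<x = subst (ℕ._< toℕ x) (base-spine v≤m)
          (closed-invariant W cl u v Su Sv (subst (ℕ._< toℕ x) (sym (base-spine u≤m)) u<x))

  -- The subtrees meeting the spine exactly in the vertices i, …, j.
  interval : ℕ → ℕ → ℕ → Constraint
  interval i j y =
    if y ≤ᵇ m then (if inside i j y then required else forbidden)
              else (if inside i j (base y) then free else forbidden)

  alone : ℕ → ℕ → Constraint
  alone x y = if y ≡ᵇ x then required else forbidden

  member : VSubset N → ℕ → Bool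
  member S x = anyV λ u → S u ∧ (toℕ u ≡ᵇ x)

  member-elim : ∀ S {x} → member S x ≡ true → ∃[ u ] (S u ≡ true × toℕ u ≡ x)
  member-elim S {x} e with anyV-elim e
  ... | u , e′ with ∧-true {S u} e′
  ...   | Su , t = u , Su , ≡ᵇ⇒≡ (toℕ u) x (≡⇒T t)

  member-intro : ∀ S u {x} → S u ≡ true → toℕ u ≡ x → member S x ≡ true
  member-intro S u {x} Su e = anyV-intro u (cong₂ _∧_ Su (T⇒≡ (≡⇒≡ᵇ (toℕ u) x e)))

  -- The first and last spine vertices of `S` give `i` and `j`; the spine between them is filled by
  -- `no-gap`, and leaves are unconstrained exactly when their base lies in between. Without a spine
  -- vertex, `S` is a single leaf by `lonely-leaf`.
  classify : ∀ S → connectedInduced caterpillar S ≡ true →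
    (∃[ i ] ∃[ j ] (i ℕ.≤ j × j ℕ.≤ m × matches (interval i j) S ≡ 1)) ⊎
    (∃[ t ] (t ℕ.< M × matches (alone (suc m + t)) S ≡ 1))
  classify S conn with least (member S) (suc m) | greatest (member S) (suc m)
  ... | inj₁ none | _ = inj₂ (toℕ u ∸ suc m , t<M ,
          matches-intro (alone (suc m + (toℕ u ∸ suc m))) S adm)
    where
    u  = proj₁ (proj₁ (connected-elim caterpillar S conn))
    Su = proj₂ (proj₁ (connected-elim caterpillar S conn))
    off : ∀ w → toℕ w ℕ.≤ m → S w ≡ false
    off w w≤m = ¬T⇒≡ λ t → true≢false (member-intro S w (T⇒≡ t) refl) (none (toℕ w) (s≤s w≤m))
    m<u : m ℕ.< toℕ u
    m<u = ≰⇒> λ u≤m → true≢false Su (off u u≤m)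
    u≡ : suc m + (toℕ u ∸ suc m) ≡ toℕ u
    u≡ = m+[n∸m]≡n m<u
    t<M : toℕ u ∸ suc m ℕ.< M
    t<M = +-cancelˡ-< (suc m) _ _ (subst (ℕ._< N) (sym u≡) (toℕ<n u))
    unique : ∀ v → S v ≡ true → v ≡ u
    unique = lonely-leaf S conn u Su m<u λ w e → off w (≤-trans (≤-reflexive e) (base≤m (toℕ u)))
    adm : ∀ v → admits (alone (suc m + (toℕ u ∸ suc m)) (toℕ v)) (S v) ≡ 1
    adm v rewrite u≡ with S v in Sv
    ... | true  rewrite unique v Sv | T⇒≡ (≡⇒≡ᵇ (toℕ u) (toℕ u) refl) = refl
    ... | false rewrite ¬T⇒≡ {toℕ v ≡ᵇ toℕ u}
            (λ t → true≢false Su (subst (λ w → S w ≡ false) (toℕ-injective (≡ᵇ⇒≡ (toℕ v) (toℕ u) t)) Sv)) = refl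
  ... | inj₂ (i , i<L , mi , _) | inj₁ none = ⊥-elim (true≢false mi (none i i<L))
  ... | inj₂ (i , i<L , mi , below) | inj₂ (j , j<L , mj , above) =
          inj₁ (i , j , i≤j , s≤s⁻¹ j<L , matches-intro (interval i j) S adm)
    where
    i≤j : i ℕ.≤ j
    i≤j = ≮⇒≥ λ j<i → true≢false mj (below j j<i)
    inside-member : ∀ w → toℕ w ℕ.≤ m → S w ≡ true → inside i j (toℕ w) ≡ true
    inside-member w w≤m Sw = cong₂ _∧_
      (≤ᵇ-true (≮⇒≥ λ w<i → true≢false (member-intro S w Sw refl) (below (toℕ w) w<i)))
      (≤ᵇ-true (≮⇒≥ λ j<w → true≢false (member-intro S w Sw refl) (above (toℕ w) j<w (s≤s w≤m))))
    uᵢ = member-elim S mi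
    uⱼ = member-elim S mj
    filled : ∀ w → inside i j (toℕ w) ≡ true → S w ≡ true
    filled w e with ∧-true {i ≤ᵇ toℕ w} e
    ... | a , b with m≤n⇒m<n∨m≡n (≤ᵇ⇒≤ i (toℕ w) (≡⇒T a)) | uᵢ | uⱼ
    ...   | inj₂ i≡w | (p , Sp , p≡i) | _ = subst (λ t → S t ≡ true) (toℕ-injective (trans p≡i i≡w)) Sp
    ...   | inj₁ i<w | (p , Sp , p≡i) | (q , Sq , q≡j) = no-gap S conn p q w Sp Sq
            (≤-trans (≤-reflexive p≡i) (s≤s⁻¹ i<L)) (≤-trans (≤-reflexive q≡j) (s≤s⁻¹ j<L))
            (≤-<-trans (≤-reflexive p≡i) i<w)
            (≤-trans (≤ᵇ⇒≤ (toℕ w) j (≡⇒T b)) (≤-reflexive (sym q≡j)))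
    adm : ∀ v → admits (interval i j (toℕ v)) (S v) ≡ 1
    adm v with toℕ v ≤ᵇ m in v≤m
    ... | true with inside i j (toℕ v) in e
    ...   | true  rewrite filled v e = refl
    ...   | false rewrite ¬T⇒≡ {S v} (λ t → true≢false (inside-member v (≤ᵇ⇒≤ (toℕ v) m (≡⇒T v≤m)) (T⇒≡ t)) e) = refl
    adm v | false with inside i j (att (toℕ v ∸ suc m)) in e
    ...   | true  = refl
    ...   | false = cong (admits forbidden) (¬T⇒≡ bad)
      where
      m<v : m ℕ.< toℕ v
      m<v = ≰⇒> λ h → true≢false (≤ᵇ-true h) v≤m
      base≡ : base (toℕ v) ≡ att (toℕ v ∸ suc m)
      base≡ rewrite v≤m = refl
      -- A leaf whose base lies outside the interval would be the whole of `S`, but `S` contains the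
      -- spine vertex `i`.
      bad : ¬ T (S v)
      bad t = <⇒≱ m<v (subst (λ w → toℕ w ℕ.≤ m) lonely (≤-trans (≤-reflexive (proj₂ (proj₂ uᵢ))) (s≤s⁻¹ i<L)))
        where
        p = proj₁ uᵢ
        off : ∀ w → toℕ w ≡ base (toℕ v) → S w ≡ false
        off w ew = ¬T⇒≡ λ t′ → true≢false
          (inside-member w (≤-trans (≤-reflexive ew) (base≤m (toℕ v))) (T⇒≡ t′))
          (trans (cong (inside i j) (trans ew base≡)) e)
        lonely : p ≡ v
        lonely = lonely-leaf S conn v (T⇒≡ t) m<v off p (proj₁ (proj₂ uᵢ))

  -- Missing vertices in each family of subtrees

  interval-spine : ∀ i j y → y ℕ.≤ m → interval i j y ≡ (if inside i j y then required else forbidden)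
  interval-spine i j y h rewrite ≤ᵇ-true h = refl

  interval-leaf : ∀ i j t → interval i j (suc m + t) ≡ (if inside i j (att t) then free else forbidden)
  interval-leaf i j t rewrite ≤ᵇ-false {suc m + t} {m} (s≤s (m≤m+n m t)) | m+n∸m≡n m t = refl

  choices-interval : ∀ i j → ∏ N (choices ∘ interval i j) ≡ ∏ M (λ t → weight (inside i j (att t)))
  choices-interval i j = trans (∏-split (suc m) M (choices ∘ interval i j))
    (trans (cong₂ _*_ (∏-one (suc m) spine) (∏-cong M λ t _ → leaf t)) (*-identityˡ _))
    where
    spine : ∀ y → y ℕ.< suc m → choices (interval i j y) ≡ 1
    spine y y<L rewrite interval-spine i j y (s≤s⁻¹ y<L) with inside i j y
    ... | true  = refl
    ... | false = refl
    leaf : ∀ t → choices (interval i j (suc m + t)) ≡ weight (inside i j (att t))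
    leaf t rewrite interval-leaf i j t with inside i j (att t)
    ... | true  = refl
    ... | false = refl

  optional-interval : ∀ i j → ∑ N (optional ∘ interval i j) ≡ ∑ (suc m) (λ y → 𝟙 (not (inside i j y))) + M
  optional-interval i j = trans (∑-split (suc m) M (optional ∘ interval i j))
    (cong₂ _+_ (∑-cong (suc m) spine) (trans (∑-cong M {g = λ _ → 1} λ t _ → leaf t) (trans (∑-const M 1) (*-identityʳ M))))
    where
    spine : ∀ y → y ℕ.< suc m → optional (interval i j y) ≡ 𝟙 (not (inside i j y))
    spine y y<L rewrite interval-spine i j y (s≤s⁻¹ y<L) with inside i j y
    ... | true  = refl
    ... | false = refl
    leaf : ∀ t → optional (interval i j (suc m + t)) ≡ 1
    leaf t rewrite interval-leaf i j t with inside i j (att t)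
    ... | true  = refl
    ... | false = refl

  right-end-missing : ∀ j d → j + d ≡ m → ∑ (suc m) (λ y → 𝟙 (not (inside 0 j y))) ≡ d
  right-end-missing j d refl = trans (∑-split (suc j) d (λ y → 𝟙 (not (inside 0 j y)))) (cong₂ _+_
    (∑-zero (suc j) λ y y≤j → cong (𝟙 ∘ not) (≤ᵇ-true (s≤s⁻¹ y≤j)))
    (trans (∑-cong d {g = λ _ → 1} λ y _ → cong (𝟙 ∘ not) (≤ᵇ-false {suc j + y} {j} (s≤s (m≤m+n j y)))) (trans (∑-const d 1) (*-identityʳ d))))

  left-end-missing : ∀ d → d ℕ.≤ m → ∑ (suc m) (λ y → 𝟙 (not (inside d m y))) ≡ d
  left-end-missing d d≤m = trans (cong (λ n → ∑ n f) (sym e)) (trans (∑-split d (suc m ∸ d) f)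
    (trans (cong₂ _+_ (trans (∑-cong d {g = λ _ → 1} before) (trans (∑-const d 1) (*-identityʳ d))) (∑-zero (suc m ∸ d) after))
           (+-identityʳ d)))
    where
    f : ℕ → ℕ
    f y = 𝟙 (not (inside d m y))
    e : d + (suc m ∸ d) ≡ suc m
    e = m+[n∸m]≡n (≤-trans d≤m (n≤1+n m))
    before : ∀ y → y ℕ.< d → f y ≡ 1
    before y y<d rewrite ≤ᵇ-false y<d = refl
    after : ∀ y → y ℕ.< suc m ∸ d → f (d + y) ≡ 0
    after y h rewrite ≤ᵇ-true (m≤m+n d y) | ≤ᵇ-true {d + y} {m} (s≤s⁻¹ (subst (d + y ℕ.<_) e (+-monoʳ-< d h))) = refl

  missingSum : (ℕ → Constraint) → ℕ
  missingSum q = ∑ˢ N λ S → matches q S * missing S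

  -- Here `suc d` spine vertices are missing and all `M` leaves are charged. The index starts at one
  -- missing vertex because the full spine is counted separately.
  left-anchored : ∀ d → d ℕ.< m → missingSum (interval 0 (m ∸ suc d)) ℕ.≤
                  (suc d + M) * ∏ M (λ t → weight (att t ≤ᵇ m ∸ suc d))
  left-anchored d d<m = ≤-trans (∑ˢ-matches-missing N (interval 0 (m ∸ suc d))) (≤-reflexive (cong₂ _*_
    (trans (optional-interval 0 (m ∸ suc d)) (cong (_+ M) (right-end-missing (m ∸ suc d) (suc d) (m∸n+n≡m d<m))))
    (choices-interval 0 (m ∸ suc d))))

  right-anchored : ∀ d → d ℕ.< m → missingSum (interval (suc d) m) ℕ.≤
                   (suc d + M) * ∏ M (λ t → weight (suc d ≤ᵇ att t))
  right-anchored d d<m = ≤-trans (∑ˢ-matches-missing N (interval (suc d) m)) (≤-reflexive (cong₂ _*_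
    (trans (optional-interval (suc d) m) (cong (_+ M) (left-end-missing (suc d) d<m)))
    (trans (choices-interval (suc d) m) (∏-cong M λ t _ → cong weight
      (trans (cong ((suc d ≤ᵇ att t) ∧_) (≤ᵇ-true (att≤m t))) (∧-identityʳ _))))))

  ∑-optional≤ : ∀ n q → ∑ n (optional ∘ q) ℕ.≤ n
  ∑-optional≤ n q = ≤-trans (∑-mono n {g = λ _ → 1} λ i _ → lem (q i)) (≤-reflexive (trans (∑-const n 1) (*-identityʳ n)))
    where
    lem : ∀ c → optional c ℕ.≤ 1
    lem required  = z≤n
    lem forbidden = ≤-refl
    lem free      = ≤-refl

  unanchored : ∀ i j → missingSum (interval i j) ℕ.≤ N * ∏ M (λ t → weight (inside i j (att t)))
  unanchored i j = ≤-trans (∑ˢ-matches-missing N (interval i j))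
    (*-mono-≤ (∑-optional≤ N (interval i j)) (≤-reflexive (choices-interval i j)))

  single-leaf : ∀ x → missingSum (alone x) ℕ.≤ N
  single-leaf x = ≤-trans (∑ˢ-matches-missing N (alone x))
    (≤-trans (*-mono-≤ (∑-optional≤ N (alone x)) (≤-reflexive (∏-one N λ y _ → lem y))) (≤-reflexive (*-identityʳ N)))
    where
    lem : ∀ y → choices (alone x y) ≡ 1
    lem y with y ≡ᵇ x
    ... | true  = refl
    ... | false = refl

  choices-full : ∏ N (choices ∘ interval 0 m) ≡ 2 ^ M
  choices-full = trans (choices-interval 0 m)
    (trans (∏-cong M {g = λ _ → 2} λ t _ → cong weight (≤ᵇ-true (att≤m t))) (∏-two M))

  -- No vertex is forbidden, so the exact average applies: half of the leaves are missing. This is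
  -- the origin of the term k, as `M` will be 2k.
  missingSum-full : 2 * missingSum (interval 0 m) ≡ M * 2 ^ M
  missingSum-full = trans (∑ˢ-matches-missing-exact N (interval 0 m) λ y _ → ok y) (cong₂ _*_
    (trans (optional-interval 0 m) (cong (_+ M) (right-end-missing m 0 (+-identityʳ m)))) choices-full)
    where
    ok : ∀ y → interval 0 m y ≢ forbidden
    ok y rewrite ≤ᵇ-true (base≤m y) with y ≤ᵇ m
    ... | true  = λ ()
    ... | false = λ ()

  full≤connected : 1 ℕ.≤ M → ∀ S → matches (interval 0 m) S ℕ.≤ 𝟙 (connectedInduced caterpillar S)
  full≤connected 1≤M S with matches-elim (interval 0 m) S
  ... | inj₁ e rewrite e = z≤n
  ... | inj₂ (e , h) = ≤-reflexive (trans e (sym (cong 𝟙 (spine-connected S 1≤M spine))))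
    where
    spine : ∀ u → toℕ u ℕ.≤ m → S u ≡ true
    spine u u≤m with S u | h u
    ... | true  | _ = refl
    ... | false | a rewrite interval-spine 0 m (toℕ u) u≤m | ≤ᵇ-true u≤m with a
    ...   | ()

  count-lower : 1 ℕ.≤ M → 2 ^ M ℕ.≤ ∑ˢ N (λ S → 𝟙 (connectedInduced caterpillar S))
  count-lower 1≤M = ≤-trans (≤-reflexive (sym (trans (∑ˢ-matches N (interval 0 m)) choices-full)))
    (∑ˢ-mono N (full≤connected 1≤M))

  -- The four sums bound the subtrees that miss only the right end of the spine, only the left end,
  -- both ends, or the whole spine. The third also runs over pairs with `suc i > j`, which can only
  -- enlarge the bound.
  rest : ℕ
  rest = ∑ m (λ d → (suc d + M) * ∏ M (λ t → weight (att t ≤ᵇ m ∸ suc d)))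
       + ∑ m (λ d → (suc d + M) * ∏ M (λ t → weight (suc d ≤ᵇ att t)))
       + ∑ m (λ i → ∑ m (λ j → N * ∏ M (λ t → weight (inside (suc i) j (att t)))))
       + ∑ M (λ _ → N)

  private
    W : (ℕ → Constraint) → VSubset N → ℕ
    W q S = matches q S * missing S

    left right inner leaf : VSubset N → ℕ
    left  S = ∑ m λ d → W (interval 0 (m ∸ suc d)) S
    right S = ∑ m λ d → W (interval (suc d) m) S
    inner S = ∑ m λ i → ∑ m λ j → W (interval (suc i) j) S
    leaf  S = ∑ M λ t → W (alone (suc m + t)) S

    cover : VSubset N → ℕ
    cover S = W (interval 0 m) S + (left S + right S + inner S + leaf S)

    connected≤cover : ∀ S → 𝟙 (connectedInduced caterpillar S) * missing S ℕ.≤ cover S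
    connected≤cover S with connectedInduced caterpillar S in conn
    ... | false = z≤n
    ... | true  = ≤-trans (≤-reflexive (*-identityˡ (missing S))) (go (classify S conn))
      where
      hit : ∀ q → matches q S ≡ 1 → missing S ℕ.≤ W q S
      hit q e rewrite e = ≤-reflexive (sym (*-identityˡ (missing S)))
      left≤ : left S ℕ.≤ cover S
      left≤ = ≤-trans (m≤m+n (left S) (right S)) (≤-trans (m≤m+n _ (inner S))
        (≤-trans (m≤m+n _ (leaf S)) (m≤n+m _ (W (interval 0 m) S))))
      right≤ : right S ℕ.≤ cover S
      right≤ = ≤-trans (m≤n+m (right S) (left S)) (≤-trans (m≤m+n _ (inner S))
        (≤-trans (m≤m+n _ (leaf S)) (m≤n+m _ (W (interval 0 m) S))))
      inner≤ : inner S ℕ.≤ cover S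
      inner≤ = ≤-trans (m≤n+m (inner S) (left S + right S))
        (≤-trans (m≤m+n _ (leaf S)) (m≤n+m _ (W (interval 0 m) S)))
      leaf≤ : leaf S ℕ.≤ cover S
      leaf≤ = ≤-trans (m≤n+m (leaf S) (left S + right S + inner S)) (m≤n+m _ (W (interval 0 m) S))
      go : (∃[ i ] ∃[ j ] (i ℕ.≤ j × j ℕ.≤ m × matches (interval i j) S ≡ 1)) ⊎
           (∃[ t ] (t ℕ.< M × matches (alone (suc m + t)) S ≡ 1)) → missing S ℕ.≤ cover S
      go (inj₂ (t , t<M , e)) = ≤-trans (hit (alone (suc m + t)) e)
        (≤-trans (∑-term M (λ t → W (alone (suc m + t)) S) t t<M) leaf≤)
      go (inj₁ (i , j , i≤j , j≤m , e)) with m≤n⇒m<n∨m≡n j≤m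
      go (inj₁ (zero , j , i≤j , j≤m , e)) | inj₂ refl =
        ≤-trans (hit (interval 0 m) e) (m≤m+n (W (interval 0 m) S) (left S + right S + inner S + leaf S))
      -- `left` is indexed by the number of missing spine vertices minus one, so the interval ending
      -- at `j` is its term `m ∸ suc j`.
      go (inj₁ (zero , j , i≤j , j≤m , e)) | inj₁ j<m =
        ≤-trans (hit (interval 0 (m ∸ suc (m ∸ suc j))) (subst (λ j → matches (interval 0 j) S ≡ 1) j≡ e))
          (≤-trans (∑-term m (λ d → W (interval 0 (m ∸ suc d)) S) (m ∸ suc j) d<m) left≤)
        where
        d≡ : suc (m ∸ suc j) ≡ m ∸ j
        d≡ = sym (+-∸-assoc 1 j<m)
        d<m : m ∸ suc j ℕ.< m
        d<m = ≤-trans (≤-reflexive d≡) (m∸n≤m m j)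
        j≡ : j ≡ m ∸ suc (m ∸ suc j)
        j≡ = sym (trans (cong (m ∸_) d≡) (m∸[m∸n]≡n j≤m))
      go (inj₁ (suc i , j , i≤j , j≤m , e)) | inj₂ refl =
        ≤-trans (hit (interval (suc i) m) e) (≤-trans (∑-term m (λ d → W (interval (suc d) m) S) i i≤j) right≤)
      go (inj₁ (suc i , j , i≤j , j≤m , e)) | inj₁ j<m =
        ≤-trans (hit (interval (suc i) j) e)
          (≤-trans (∑-term m (λ j → W (interval (suc i) j) S) j j<m)
          (≤-trans (∑-term m (λ i → ∑ m (λ j → W (interval (suc i) j) S)) i (≤-trans i≤j j≤m)) inner≤))

  missing-bound : 2 * ∑ˢ N (λ S → 𝟙 (connectedInduced caterpillar S) * missing S) ℕ.≤ M * 2 ^ M + 2 * rest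
  missing-bound = ≤-trans (*-monoʳ-≤ 2 (≤-trans (∑ˢ-mono N connected≤cover) (≤-trans (≤-reflexive distribute)
      (+-monoʳ-≤ (missingSum (interval 0 m)) bounds))))
      (≤-reflexive (trans (*-distribˡ-+ 2 (missingSum (interval 0 m)) rest) (cong (_+ 2 * rest) missingSum-full)))
    where
    distribute : ∑ˢ N cover ≡ missingSum (interval 0 m)
      + (∑ m (λ d → missingSum (interval 0 (m ∸ suc d)))
      + ∑ m (λ d → missingSum (interval (suc d) m))
      + ∑ m (λ i → ∑ m (λ j → missingSum (interval (suc i) j)))
      + ∑ M (λ t → missingSum (alone (suc m + t))))
    distribute =
      trans (∑ˢ-+ N (W (interval 0 m)) (λ S → left S + right S + inner S + leaf S)) (cong (missingSum (interval 0 m) +_)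
      (trans (∑ˢ-+ N (λ S → left S + right S + inner S) leaf) (cong₂ _+_
      (trans (∑ˢ-+ N (λ S → left S + right S) inner) (cong₂ _+_
      (trans (∑ˢ-+ N left right) (cong₂ _+_
        (∑ˢ-∑ N m λ d → W (interval 0 (m ∸ suc d)))
        (∑ˢ-∑ N m λ d → W (interval (suc d) m))))
        (trans (∑ˢ-∑ N m λ i S → ∑ m (λ j → W (interval (suc i) j) S))
               (∑-cong m λ i _ → ∑ˢ-∑ N m λ j → W (interval (suc i) j)))))
        (∑ˢ-∑ N M λ t → W (alone (suc m + t))))))
    bounds = +-mono-≤ (+-mono-≤ (+-mono-≤
      (∑-mono m {λ d → missingSum (interval 0 (m ∸ suc d))} left-anchored)
      (∑-mono m {λ d → missingSum (interval (suc d) m)} right-anchored))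
      (∑-mono m {λ i → ∑ m (λ j → missingSum (interval (suc i) j))} λ i _ →
        ∑-mono m {λ j → missingSum (interval (suc i) j)} λ j _ → unanchored (suc i) j))
      (∑-mono M {λ t → missingSum (alone (suc m + t))} λ t _ → single-leaf (suc m + t))

  caterpillar-tree : 1 ℕ.≤ M → IsTree caterpillar
  caterpillar-tree 1≤M = parentGraph-simple N par , spine-connected (λ _ → true) 1≤M (λ _ _ → refl) ,
    parentGraph-edgeCount N par par≤

-- Choice of the leaves

-- With b₁ ≥ b₂ ≥ b₃ ≥ b₄ this is an equality.
weights≤ : ∀ b₁ b₂ b₃ b₄ → weight b₁ * (weight b₂ * (weight b₃ * weight b₄)) ℕ.≤
           1 + 𝟙 b₁ + 2 * 𝟙 b₂ + 4 * 𝟙 b₃ + 8 * 𝟙 b₄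
weights≤ false false false false = ≤ᵇ⇒≤ _ _ _
weights≤ false false false true  = ≤ᵇ⇒≤ _ _ _
weights≤ false false true  false = ≤ᵇ⇒≤ _ _ _
weights≤ false false true  true  = ≤ᵇ⇒≤ _ _ _
weights≤ false true  false false = ≤ᵇ⇒≤ _ _ _
weights≤ false true  false true  = ≤ᵇ⇒≤ _ _ _
weights≤ false true  true  false = ≤ᵇ⇒≤ _ _ _
weights≤ false true  true  true  = ≤ᵇ⇒≤ _ _ _
weights≤ true  false false false = ≤ᵇ⇒≤ _ _ _
weights≤ true  false false true  = ≤ᵇ⇒≤ _ _ _
weights≤ true  false true  false = ≤ᵇ⇒≤ _ _ _
weights≤ true  false true  true  = ≤ᵇ⇒≤ _ _ _
weights≤ true  true  false false = ≤ᵇ⇒≤ _ _ _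
weights≤ true  true  false true  = ≤ᵇ⇒≤ _ _ _
weights≤ true  true  true  false = ≤ᵇ⇒≤ _ _ _
weights≤ true  true  true  true  = ≤ᵇ⇒≤ _ _ _

weight≤2 : ∀ b → weight b ℕ.≤ 2
weight≤2 true  = ≤-refl
weight≤2 false = s≤s z≤n

∑-truncate : ∀ m q (g : ℕ → ℕ) → q ℕ.≤ m → ∑ m (λ d → g d * 𝟙 (suc d ≤ᵇ q)) ≡ ∑ q g
∑-truncate m q g q≤m = trans (cong (λ m → ∑ m f) (sym (m+[n∸m]≡n q≤m))) (trans (∑-split q (m ∸ q) f)
  (trans (cong₂ _+_ (∑-cong q inside-range) (∑-zero (m ∸ q) λ d _ → outside d)) (+-identityʳ _)))
  where
  f : ℕ → ℕ
  f d = g d * 𝟙 (suc d ≤ᵇ q)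
  inside-range : ∀ d → d ℕ.< q → f d ≡ g d
  inside-range d d<q rewrite ≤ᵇ-true d<q = *-identityʳ (g d)
  outside : ∀ d → f (q + d) ≡ 0
  outside d rewrite ≤ᵇ-false {suc (q + d)} {q} (s≤s (m≤m+n q d)) = *-zeroʳ (g (q + d))

arithmetic-sum : ∀ q c → 2 * ∑ q (λ d → suc d + c) ≡ q * (q + (1 + 2 * c))
arithmetic-sum zero    c = refl
arithmetic-sum (suc q) c = trans (cong (λ z → 2 * (suc c + z)) (∑-+ q (λ _ → 1) (λ d → suc d + c)))
  (trans (cong (λ z → 2 * (suc c + (z + ∑ q (λ d → suc d + c)))) (trans (∑-const q 1) (*-identityʳ q)))
  (trans (a-lem c q (∑ q (λ d → suc d + c))) (trans (cong (2 * (suc c + q) +_) (arithmetic-sum q c)) (b-lem q c))))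
  where
  a-lem : ∀ c q x → 2 * (1 + c + (q + x)) ≡ 2 * (1 + c + q) + 2 * x
  a-lem = solve-∀
  b-lem : ∀ q c → 2 * (1 + c + q) + q * (q + (1 + 2 * c)) ≡ (1 + q) * (1 + q + (1 + 2 * c))
  b-lem = solve-∀

^-one : ∀ s {x} → x ≡ 1 → x ^ s ≡ 1
^-one s refl = ^-zeroˡ s

≤∸-swap : ∀ {x m d} → d ℕ.≤ m → x ℕ.≤ m ∸ d → d ℕ.≤ m ∸ x
≤∸-swap {x} {m} {d} d≤m h =
  m+n≤o⇒m≤o∸n d (subst (ℕ._≤ m) (+-comm x d) (subst (x + d ℕ.≤_) (m∸n+n≡m d≤m) (+-monoˡ-≤ d h)))

-- Reversing the spine exchanges the two kinds of anchored intervals; as the middle leaves will be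
-- placed symmetrically, both sides obey the same bound.
≤ᵇ-reflect : ∀ {x m d} → x ℕ.≤ m → d ℕ.≤ m → (x ≤ᵇ m ∸ d) ≡ (d ≤ᵇ m ∸ x)
≤ᵇ-reflect {x} {m} {d} x≤m d≤m with x ≤ᵇ m ∸ d in e
... | true  = sym (≤ᵇ-true (≤∸-swap {x} {m} {d} d≤m (≤ᵇ⇒≤ x (m ∸ d) (≡⇒T e))))
... | false = sym (≤ᵇ-false {d} {m ∸ x} (≰⇒> λ h → true≢false (≤ᵇ-true (≤∸-swap {d} {m} {x} x≤m h)) e))

ends : ℕ → ℕ → ℕ
ends m zero          = 0
ends m (suc zero)    = m
ends m (suc (suc t)) = ends m t

ends≤ : ∀ m t → ends m t ℕ.≤ m
ends≤ m zero          = z≤n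
ends≤ m (suc zero)    = ≤-refl
ends≤ m (suc (suc t)) = ends≤ m t

∏-ends : ∀ m s (f : ℕ → ℕ) → ∏ (s * 2) (f ∘ ends m) ≡ (f 0 * f m) ^ s
∏-ends m zero    f = refl
∏-ends m (suc s) f = trans (sym (*-assoc (f 0) (f m) _)) (cong (f 0 * f m *_) (∏-ends m s f))

-- Twice the cost of one side divided by `2 ^ s`, summed in closed form (`2B≡`). The leading
-- coefficient is 81 + 64 + 2 * 36 + 4 * 9 + 8 = 261; the denominator 324 is 4 * 81, from
-- `2 ^ k = 4 * 2 ^ s` and n ≈ 9h.
anchored : ℕ → ℕ → ℕ → ℕ
anchored h r s =
  let c = 1 + 2 * (4 + s * 2) in
  (h * 9 + r) * (h * 9 + r + c) + (h * 8 + r) * (h * 8 + r + c)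
  + 2 * ((h * 6 + r) * (h * 6 + r + c)) + 4 * (h * 3 * (h * 3 + c))
  + 8 * (h * (h + c))

-- The remainder `r` of the spine length on division by nine goes into the middle gap, from `h * 3`
-- to `h * 6 + r`, so that the leaf positions stay exactly symmetric.
module FourMiddleLeaves (h r s : ℕ) where

  m M : ℕ
  m = h * 9 + r
  M = 4 + s * 2

  -- For middle leaves at positions u₁ ≤ u₂ ≤ u₃ ≤ u₄ symmetric in [0, 1], the subtrees containing one end
  -- of the spine cost u₁²/2 + u₂²/4 + u₃²/8 + u₄²/16 + 1/16 (times a constant), which is least for
  -- u₁ = 1/9 and u₂ = 1/3.
  att : ℕ → ℕ
  att 0 = h
  att 1 = h * 3
  att 2 = h * 6 + r
  att 3 = h * 8 + r
  att (suc (suc (suc (suc t)))) = ends m t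

  h≤m : h ℕ.≤ m
  h≤m = ≤-trans (≤-trans (≤-reflexive (sym (*-identityʳ h))) (*-monoʳ-≤ h (≤ᵇ⇒≤ 1 9 _))) (m≤m+n (h * 9) r)

  3h≤m : h * 3 ℕ.≤ m
  3h≤m = ≤-trans (*-monoʳ-≤ h (≤ᵇ⇒≤ 3 9 _)) (m≤m+n (h * 9) r)

  6h≤m : h * 6 + r ℕ.≤ m
  6h≤m = +-monoˡ-≤ r (*-monoʳ-≤ h (≤ᵇ⇒≤ 6 9 _))

  8h≤m : h * 8 + r ℕ.≤ m
  8h≤m = +-monoˡ-≤ r (*-monoʳ-≤ h (≤ᵇ⇒≤ 8 9 _))

  att≤m : ∀ t → att t ℕ.≤ m
  att≤m 0 = h≤m
  att≤m 1 = 3h≤m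
  att≤m 2 = 6h≤m
  att≤m 3 = 8h≤m
  att≤m (suc (suc (suc (suc t)))) = ends≤ m t

  open Caterpillar m M att att≤m public

  ∏-att : ∀ f → ∏ M (f ∘ att) ≡ f h * (f (h * 3) * (f (h * 6 + r) * f (h * 8 + r))) * (f 0 * f m) ^ s
  ∏-att f = trans (cong (λ z → f h * (f (h * 3) * (f (h * 6 + r) * (f (h * 8 + r) * z)))) (∏-ends m s f))
    (lem (f h) (f (h * 3)) (f (h * 6 + r)) (f (h * 8 + r)) _)
    where
    lem : ∀ a b c d e → a * (b * (c * (d * e))) ≡ a * (b * (c * d)) * e
    lem = solve-∀

  -- The product of the four middle weights, made linear in the indicators by `weights≤`; its sum
  -- over `d` then splits into truncated arithmetic sums.
  V : ℕ → ℕ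
  V d = 1 + 𝟙 (suc d ≤ᵇ h * 8 + r) + 2 * 𝟙 (suc d ≤ᵇ h * 6 + r) + 4 * 𝟙 (suc d ≤ᵇ h * 3) + 8 * 𝟙 (suc d ≤ᵇ h)

  left-weight : ∀ d → d ℕ.< m → ∏ M (λ t → weight (att t ≤ᵇ m ∸ suc d)) ℕ.≤ V d * 2 ^ s
  left-weight d d<m = ≤-trans (≤-reflexive (∏-att f)) (*-mono-≤ middle (≤-reflexive (cong (_^ s) ends-weight)))
    where
    f : ℕ → ℕ
    f x = weight (x ≤ᵇ m ∸ suc d)
    -- Of each pair of end leaves, only the one at the anchored end is available.
    ends-weight : f 0 * f m ≡ 2
    ends-weight rewrite ≤ᵇ-false {m} {m ∸ suc d} (∸-monoʳ-< (s≤s z≤n) d<m) = refl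
    reflect : ∀ x y → y ℕ.≤ m → x + y ≡ m → f x ≡ weight (suc d ≤ᵇ y)
    reflect x y y≤m e = cong weight (trans (≤ᵇ-reflect (subst (x ℕ.≤_) e (m≤m+n x y)) d<m)
      (cong (suc d ≤ᵇ_) (trans (cong (_∸ x) (sym e)) (m+n∸m≡n x y))))
    e₁ : ∀ h r → h + (h * 8 + r) ≡ h * 9 + r
    e₁ = solve-∀
    e₂ : ∀ h r → h * 3 + (h * 6 + r) ≡ h * 9 + r
    e₂ = solve-∀
    middle : f h * (f (h * 3) * (f (h * 6 + r) * f (h * 8 + r))) ℕ.≤ V d
    middle = ≤-trans (≤-reflexive (cong₂ _*_ (reflect h (h * 8 + r) 8h≤m (e₁ h r)) (cong₂ _*_ (reflect (h * 3) (h * 6 + r) 6h≤m (e₂ h r))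
      (cong₂ _*_ (reflect (h * 6 + r) (h * 3) 3h≤m (trans (+-comm (h * 6 + r) (h * 3)) (e₂ h r)))
                 (reflect (h * 8 + r) h h≤m (trans (+-comm (h * 8 + r) h) (e₁ h r)))))))
      (weights≤ (suc d ≤ᵇ h * 8 + r) (suc d ≤ᵇ h * 6 + r) (suc d ≤ᵇ h * 3) (suc d ≤ᵇ h))

  right-weight : ∀ d → d ℕ.< m → ∏ M (λ t → weight (suc d ≤ᵇ att t)) ℕ.≤ V d * 2 ^ s
  right-weight d d<m = ≤-trans (≤-reflexive (∏-att f)) (*-mono-≤ middle (≤-reflexive (cong (_^ s) ends-weight)))
    where
    f : ℕ → ℕ
    f x = weight (suc d ≤ᵇ x)
    ends-weight : f 0 * f m ≡ 2
    ends-weight rewrite ≤ᵇ-true d<m = refl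
    lem : ∀ a b c d → a * (b * (c * d)) ≡ d * (c * (b * a))
    lem = solve-∀
    middle : f h * (f (h * 3) * (f (h * 6 + r) * f (h * 8 + r))) ℕ.≤ V d
    middle = ≤-trans (≤-reflexive (lem (f h) (f (h * 3)) (f (h * 6 + r)) (f (h * 8 + r))))
      (weights≤ (suc d ≤ᵇ h * 8 + r) (suc d ≤ᵇ h * 6 + r) (suc d ≤ᵇ h * 3) (suc d ≤ᵇ h))

  -- An interval avoiding both ends carries no end leaf, so at most the four middle leaves are free.
  inner-weight : ∀ i j → j ℕ.< m → ∏ M (λ t → weight (inside (suc i) j (att t))) ℕ.≤ 16
  inner-weight i j j<m = ≤-trans (≤-reflexive (∏-att f)) (*-mono-≤ middle (≤-reflexive (^-one s ends-weight)))
    where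
    f : ℕ → ℕ
    f x = weight (inside (suc i) j x)
    f≤2 : ∀ x → f x ℕ.≤ 2
    f≤2 x = weight≤2 (inside (suc i) j x)
    ends-weight : f 0 * f m ≡ 1
    ends-weight rewrite ≤ᵇ-false {m} {j} j<m | ∧-zeroʳ (suc i ≤ᵇ m) = refl
    middle : f h * (f (h * 3) * (f (h * 6 + r) * f (h * 8 + r))) ℕ.≤ 16
    middle = *-mono-≤ (f≤2 h) (*-mono-≤ (f≤2 (h * 3)) (*-mono-≤ (f≤2 (h * 6 + r)) (f≤2 (h * 8 + r))))

  T₁ : ℕ → ℕ
  T₁ q = ∑ q (λ d → suc d + M)

  B : ℕ
  B = ∑ m (λ d → (suc d + M) * V d)

  B≡ : B ≡ T₁ m + T₁ (h * 8 + r) + 2 * T₁ (h * 6 + r) + 4 * T₁ (h * 3) + 8 * T₁ h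
  B≡ = trans (∑-cong m λ d _ → lem (g d) (χ (h * 8 + r) d) (χ (h * 6 + r) d) (χ (h * 3) d) (χ h d))
    (trans (∑-+ m (λ d → g d + A (h * 8 + r) d + 2 * A (h * 6 + r) d + 4 * A (h * 3) d) (λ d → 8 * A h d))
    (cong₂ _+_ (trans (∑-+ m (λ d → g d + A (h * 8 + r) d + 2 * A (h * 6 + r) d) (λ d → 4 * A (h * 3) d))
    (cong₂ _+_ (trans (∑-+ m (λ d → g d + A (h * 8 + r) d) (λ d → 2 * A (h * 6 + r) d))
    (cong₂ _+_ (trans (∑-+ m g (A (h * 8 + r))) (cong (T₁ m +_) (∑-truncate m (h * 8 + r) g 8h≤m)))
      (part 2 6h≤m))) (part 4 3h≤m))) (part 8 h≤m)))
    where
    g : ℕ → ℕ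
    g d = suc d + M
    χ A : ℕ → ℕ → ℕ
    χ q d = 𝟙 (suc d ≤ᵇ q)
    A q d = g d * χ q d
    lem : ∀ g a b c d → g * (1 + a + 2 * b + 4 * c + 8 * d) ≡ g + g * a + 2 * (g * b) + 4 * (g * c) + 8 * (g * d)
    lem = solve-∀
    part : ∀ c {q} → q ℕ.≤ m → ∑ m (λ d → c * A q d) ≡ c * T₁ q
    part c {q} q≤m = trans (∑-*ˡ m c (A q)) (cong (c *_) (∑-truncate m q g q≤m))

  2B≡ : 2 * B ≡ anchored h r s
  2B≡ = trans (cong (2 *_) B≡) (trans (lem (T₁ m) (T₁ (h * 8 + r)) (T₁ (h * 6 + r)) (T₁ (h * 3)) (T₁ h))
    (cong₂ _+_ (cong₂ _+_ (cong₂ _+_ (cong₂ _+_ (arithmetic-sum m M) (arithmetic-sum (h * 8 + r) M))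
      (cong (2 *_) (arithmetic-sum (h * 6 + r) M))) (cong (4 *_) (arithmetic-sum (h * 3) M)))
      (cong (8 *_) (arithmetic-sum h M))))
    where
    lem : ∀ a b c d e → 2 * (a + b + 2 * c + 4 * d + 8 * e) ≡ 2 * a + 2 * b + 2 * (2 * c) + 4 * (2 * d) + 8 * (2 * e)
    lem = solve-∀

  rest≤ : rest ℕ.≤ 2 * B * 2 ^ s + m * (m * (N * 16)) + M * N
  rest≤ = ≤-trans (+-mono-≤ (+-mono-≤ (+-mono-≤ (one-side left-weight) (one-side right-weight)) inner)
      (≤-reflexive (∑-const M N)))
      (≤-reflexive (cong (λ z → z + m * (m * (N * 16)) + M * N) (lem B (2 ^ s))))
    where
    lem : ∀ b p → b * p + b * p ≡ 2 * b * p
    lem = solve-∀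
    one-side : ∀ {w : ℕ → ℕ} → (∀ d → d ℕ.< m → w d ℕ.≤ V d * 2 ^ s) → ∑ m (λ d → (suc d + M) * w d) ℕ.≤ B * 2 ^ s
    one-side {w} w≤ = ≤-trans (∑-mono m λ d d<m → *-monoʳ-≤ (suc d + M) (w≤ d d<m))
      (≤-reflexive (trans (∑-cong m λ d _ → comm (suc d + M) (V d) (2 ^ s))
        (trans (∑-*ˡ m (2 ^ s) (λ d → (suc d + M) * V d)) (*-comm (2 ^ s) B))))
      where
      comm : ∀ a b c → a * (b * c) ≡ c * (a * b)
      comm = solve-∀
    inner : ∑ m (λ i → ∑ m (λ j → N * ∏ M (λ t → weight (inside (suc i) j (att t))))) ℕ.≤ m * (m * (N * 16))
    inner = ≤-trans (∑-mono m λ i _ → ≤-trans (∑-mono m λ j j<m → *-monoʳ-≤ N (inner-weight i j j<m))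
      (≤-reflexive (∑-const m (N * 16)))) (≤-reflexive (∑-const m (m * (N * 16))))

-- Numerical estimates

anchored-mono : ∀ h {r r′} s → r ℕ.≤ r′ → anchored h r s ℕ.≤ anchored h r′ s
anchored-mono h {r} {r′} s r≤r′ = +-monoˡ-≤ _ (+-monoˡ-≤ _ (+-mono-≤ (+-mono-≤ (mono (h * 9)) (mono (h * 8)))
  (*-monoʳ-≤ 2 (mono (h * 6)))))
  where
  mono : ∀ a → (a + r) * (a + r + (1 + 2 * (4 + s * 2))) ℕ.≤ (a + r′) * (a + r′ + (1 + 2 * (4 + s * 2)))
  mono a = *-mono-≤ (+-monoʳ-≤ a r≤r′) (+-monoˡ-≤ _ (+-monoʳ-≤ a r≤r′))

-- Since 1045 / 4 = 261.25, a quarter of h² is left for the lower order terms. Substituting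
-- `h = s * 1000 + 10000 + g` turns the claim into a polynomial identity with an explicit
-- nonnegative remainder.
anchored≤ : ∀ h s → s * 1000 + 10000 ℕ.≤ h → anchored h 8 s * 4 ℕ.≤ h * h * 1045
anchored≤ h s le = subst (λ h → anchored h 8 s * 4 ℕ.≤ h * h * 1045) (m+[n∸m]≡n le)
  (≤-trans (m≤m+n _ _) (≤-reflexive (slack s (h ∸ (s * 1000 + 10000)))))
  where
  slack : ∀ s g →
    ((((s * 1000 + 10000 + g) * 9 + 8) * ((s * 1000 + 10000 + g) * 9 + 8 + (1 + 2 * (4 + s * 2)))
    + ((s * 1000 + 10000 + g) * 8 + 8) * ((s * 1000 + 10000 + g) * 8 + 8 + (1 + 2 * (4 + s * 2)))
    + 2 * (((s * 1000 + 10000 + g) * 6 + 8) * ((s * 1000 + 10000 + g) * 6 + 8 + (1 + 2 * (4 + s * 2))))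
    + 4 * ((s * 1000 + 10000 + g) * 3 * ((s * 1000 + 10000 + g) * 3 + (1 + 2 * (4 + s * 2))))
    + 8 * ((s * 1000 + 10000 + g) * ((s * 1000 + 10000 + g) + (1 + 2 * (4 + s * 2)))))) * 4
    + (s * s * 216000 + s * 8539488 + 63797824 + g * (s * 1216 + 16380) + g * g)
    ≡ (s * 1000 + 10000 + g) * (s * 1000 + 10000 + g) * 1045
  slack = solve-∀

module DeficitBound (h r s : ℕ) (r≤8 : r ℕ.≤ 8) (large : s * 1000 + 10000 ℕ.≤ h) (8h²≤2^s : 8 * (h * h) ℕ.≤ 2 ^ s) where
  open FourMiddleLeaves h r s
  open ≤-Reasoning

  10000≤h : 10000 ℕ.≤ h
  10000≤h = ≤-trans (m≤n+m 10000 (s * 1000)) large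

  small≤h : 13 + s * 2 ℕ.≤ h
  small≤h = ≤-trans (≤-reflexive (+-comm 13 (s * 2)))
    (≤-trans (+-mono-≤ (*-monoʳ-≤ s (≤ᵇ⇒≤ 2 1000 _)) (≤ᵇ⇒≤ 13 10000 _)) large)

  9h≤N : h * 9 ℕ.≤ N
  9h≤N = ≤-trans (m≤m+n (h * 9) r) (≤-trans (n≤1+n m) (m≤m+n (suc m) M))

  N≤10h : N ℕ.≤ h * 10
  N≤10h = begin
    suc (h * 9 + r) + (4 + s * 2)  ≡⟨ l₁ h r s ⟩
    h * 9 + (r + (5 + s * 2))      ≤⟨ +-monoʳ-≤ (h * 9) (+-monoˡ-≤ (5 + s * 2) r≤8) ⟩
    h * 9 + (13 + s * 2)           ≤⟨ +-monoʳ-≤ (h * 9) small≤h ⟩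
    h * 9 + h                      ≡⟨ l₂ h ⟩
    h * 10                         ∎
    where
    l₁ : ∀ h r s → 1 + (h * 9 + r) + (4 + s * 2) ≡ h * 9 + (r + (5 + s * 2))
    l₁ = solve-∀
    l₂ : ∀ h → h * 9 + h ≡ h * 10
    l₂ = solve-∀

  m≤10h : m ℕ.≤ h * 10
  m≤10h = ≤-trans (≤-trans (n≤1+n m) (m≤m+n (suc m) M)) N≤10h

  M≤h : M ℕ.≤ h
  M≤h = ≤-trans (+-monoˡ-≤ (s * 2) (≤ᵇ⇒≤ 4 13 _)) small≤h

  -- The left side is cubic in `h`, while `2 ^ s` is at least 8h²; the factor `10000 ≤ h` still to
  -- spare pushes the constant down to 21.
  unanchored≤ : (m * (m * (N * 16)) + M * N) * 100 ℕ.≤ h * h * 2 ^ s * 21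
  unanchored≤ = begin
    (m * (m * (N * 16)) + M * N) * 100
      ≤⟨ *-monoˡ-≤ 100 (+-mono-≤ (*-mono-≤ m≤10h (*-mono-≤ m≤10h (*-monoˡ-≤ 16 N≤10h))) (*-mono-≤ M≤h N≤10h)) ⟩
    (h * 10 * (h * 10 * (h * 10 * 16)) + h * (h * 10)) * 100
      ≡⟨ l₁ h ⟩
    h * h * (h * 1600000 + 1000)
      ≤⟨ *-monoʳ-≤ (h * h) (+-monoʳ-≤ (h * 1600000) (≤-trans (≤ᵇ⇒≤ 1000 10000 _) 10000≤h)) ⟩
    h * h * (h * 1600000 + h)
      ≤⟨ *-monoʳ-≤ (h * h) (≤-trans (≤-reflexive (l₂ h)) (*-monoʳ-≤ h (≤ᵇ⇒≤ 1600001 1680000 _))) ⟩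
    h * h * (h * 1680000)
      ≡⟨ l₃ h ⟩
    h * (8 * (h * h)) * 10000 * 21
      ≤⟨ *-monoˡ-≤ 21 (*-mono-≤ (*-monoʳ-≤ h 8h²≤2^s) 10000≤h) ⟩
    h * 2 ^ s * h * 21
      ≡⟨ l₄ h (2 ^ s) ⟩
    h * h * 2 ^ s * 21 ∎
    where
    l₁ : ∀ h → (h * 10 * (h * 10 * (h * 10 * 16)) + h * (h * 10)) * 100 ≡ h * h * (h * 1600000 + 1000)
    l₁ = solve-∀
    l₂ : ∀ h → h * 1600000 + h ≡ h * 1600001
    l₂ = solve-∀
    l₃ : ∀ h → h * h * (h * 1680000) ≡ h * (8 * (h * h)) * 10000 * 21
    l₃ = solve-∀
    l₄ : ∀ h P → h * P * h * 21 ≡ h * h * P * 21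
    l₄ = solve-∀

  -- In units of h² 2^s, after scaling by 100: the anchored subtrees use 1045 * 25 = 26125, the
  -- others 21, and 81 * 81 * 4 = 26244 is allowed.
  rest-bound : rest * 100 ℕ.≤ 81 * (N * N) * (4 * 2 ^ s)
  rest-bound = begin
    rest * 100
      ≤⟨ *-monoˡ-≤ 100 rest≤ ⟩
    (2 * B * 2 ^ s + m * (m * (N * 16)) + M * N) * 100
      ≡⟨ l₁ (2 * B) (2 ^ s) (m * (m * (N * 16))) (M * N) ⟩
    2 * B * 4 * 2 ^ s * 25 + (m * (m * (N * 16)) + M * N) * 100
      ≤⟨ +-mono-≤ (*-monoˡ-≤ 25 (*-monoˡ-≤ (2 ^ s) 2B*4≤)) unanchored≤ ⟩
    h * h * 1045 * 2 ^ s * 25 + h * h * 2 ^ s * 21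
      ≡⟨ l₂ h (2 ^ s) ⟩
    h * h * 2 ^ s * 26146
      ≤⟨ *-monoʳ-≤ (h * h * 2 ^ s) (≤ᵇ⇒≤ 26146 26244 _) ⟩
    h * h * 2 ^ s * 26244
      ≡⟨ l₃ h (2 ^ s) ⟩
    81 * (h * 9 * (h * 9)) * (4 * 2 ^ s)
      ≤⟨ *-monoˡ-≤ (4 * 2 ^ s) (*-monoʳ-≤ 81 (*-mono-≤ 9h≤N 9h≤N)) ⟩
    81 * (N * N) * (4 * 2 ^ s) ∎
    where
    2B*4≤ : 2 * B * 4 ℕ.≤ h * h * 1045
    2B*4≤ = ≤-trans (*-monoˡ-≤ 4 (≤-trans (≤-reflexive 2B≡) (anchored-mono h s r≤8))) (anchored≤ h s large)
    l₁ : ∀ b P x y → (b * P + x + y) * 100 ≡ b * 4 * P * 25 + (x + y) * 100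
    l₁ = solve-∀
    l₂ : ∀ h P → h * h * 1045 * P * 25 + h * h * P * 21 ≡ h * h * P * 26146
    l₂ = solve-∀
    l₃ : ∀ h P → h * h * P * 26244 ≡ 81 * (h * 9 * (h * 9)) * (4 * P)
    l₃ = solve-∀

-- From natural to rational inequalities

toℚᵘ-/ : ∀ a b → ℚ.toℚᵘ ((ℤ.+ a) ℚ./ suc b) ℚᵘ.≃ ℚᵘ.mkℚᵘ (ℤ.+ a) b
toℚᵘ-/ a b = ℚ.toℚᵘ-fromℚᵘ (ℚᵘ.mkℚᵘ (ℤ.+ a) b)

-- Over unnormalised rationals a sum of fractions is the cross-multiplied one by computation, so the
-- claim reduces to the inequality of naturals.
≤-fractions : ∀ n k a b c d → n * (suc b * suc d) ℕ.≤ c * suc b + k * (suc b * suc d) + a * suc d →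
              ℕtoℚ n ℚ.≤ divℕ c (suc d) ℚ.+ divℕ a (suc b) ℚ.+ ℕtoℚ k
≤-fractions n k a b c d le = ℚ.toℚᵘ-cancel-≤ (begin
  ℚ.toℚᵘ (ℕtoℚ n)                              ≃⟨ toℚᵘ-/ n 0 ⟩
  ℚᵘ.mkℚᵘ (ℤ.+ n) 0                            ≤⟨ ℚᵘ.*≤* cross ⟩
  ℚᵘ.mkℚᵘ (ℤ.+ c) d ℚᵘ.+ ℚᵘ.mkℚᵘ (ℤ.+ a) b ℚᵘ.+ ℚᵘ.mkℚᵘ (ℤ.+ k) 0
    ≃⟨ ℚᵘ.+-cong (ℚᵘ.+-cong (toℚᵘ-/ c d) (toℚᵘ-/ a b)) (toℚᵘ-/ k 0) ⟨
  ℚ.toℚᵘ (divℕ c (suc d)) ℚᵘ.+ ℚ.toℚᵘ (divℕ a (suc b)) ℚᵘ.+ ℚ.toℚᵘ (ℕtoℚ k)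
    ≃⟨ ℚᵘ.+-congˡ (ℚ.toℚᵘ (ℕtoℚ k)) (ℚ.toℚᵘ-homo-+ (divℕ c (suc d)) (divℕ a (suc b))) ⟨
  ℚ.toℚᵘ (divℕ c (suc d) ℚ.+ divℕ a (suc b)) ℚᵘ.+ ℚ.toℚᵘ (ℕtoℚ k)
    ≃⟨ ℚ.toℚᵘ-homo-+ (divℕ c (suc d) ℚ.+ divℕ a (suc b)) (ℕtoℚ k) ⟨
  ℚ.toℚᵘ (divℕ c (suc d) ℚ.+ divℕ a (suc b) ℚ.+ ℕtoℚ k) ∎)
  where
  open ℚᵘ.≤-Reasoning
  D = suc d
  E = suc b
  numerator : (ℤ.+ c ℤ.* ℤ.+ E ℤ.+ ℤ.+ a ℤ.* ℤ.+ D) ℤ.* ℤ.+ 1 ℤ.+ ℤ.+ k ℤ.* ℤ.+ (D * E)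
              ≡ ℤ.+ ((c * E + a * D) * 1 + k * (D * E))
  numerator rewrite sym (ℤ.pos-* c E) | sym (ℤ.pos-* a D) | sym (ℤ.pos-* (c * E + a * D) 1)
    | sym (ℤ.pos-* k (D * E)) = refl
  lhs : ∀ n x y → n * (x * y * 1) ≡ n * (y * x)
  lhs = solve-∀
  rhs : ∀ c k a x y → c * x + k * (x * y) + a * y ≡ ((c * x + a * y) * 1 + k * (y * x)) * 1
  rhs = solve-∀
  cross : ℤ.+ n ℤ.* ℤ.+ (D * E * 1) ℤ.≤
          ((ℤ.+ c ℤ.* ℤ.+ E ℤ.+ ℤ.+ a ℤ.* ℤ.+ D) ℤ.* ℤ.+ 1 ℤ.+ ℤ.+ k ℤ.* ℤ.+ (D * E)) ℤ.* ℤ.+ 1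
  cross rewrite numerator | sym (ℤ.pos-* n (D * E * 1)) | sym (ℤ.pos-* ((c * E + a * D) * 1 + k * (D * E)) 1) =
    ℤ.+≤+ (≤-trans (≤-reflexive (lhs n D E)) (≤-trans le (≤-reflexive (rhs c k a E D))))

-- The trailing `- 0ℚ` is the value of ε in the theorem.
≤-+⇒-≤ : ∀ p q r s → p ℚ.≤ r ℚ.+ s ℚ.+ q → ((p - q) - s) - 0ℚ ℚ.≤ r
≤-+⇒-≤ p q r s h = begin
  ((p - q) - s) - 0ℚ              ≡⟨ ℚ.+-identityʳ ((p - q) - s) ⟩
  (p - q) - s                     ≤⟨ ℚ.+-monoˡ-≤ (ℚ.- s) (ℚ.+-monoˡ-≤ (ℚ.- q) h) ⟩
  (r ℚ.+ s ℚ.+ q - q) - s         ≡⟨ cong (_- s) (cancel (r ℚ.+ s) q) ⟩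
  r ℚ.+ s - s                     ≡⟨ cancel r s ⟩
  r                               ∎
  where
  open ℚ.≤-Reasoning
  cancel : ∀ x y → x ℚ.+ y - y ≡ x
  cancel x y = trans (ℚ.+-assoc x y (ℚ.- y)) (trans (cong (x ℚ.+_) (ℚ.+-inverseʳ y)) (ℚ.+-identityʳ x))

fraction-bound : ∀ n k a b c d → 1 ℕ.≤ b → 1 ℕ.≤ d → n * (b * d) ℕ.≤ c * b + k * (b * d) + a * d →
                 ((ℕtoℚ n - ℕtoℚ k) - divℕ a b) - 0ℚ ℚ.≤ divℕ c d
fraction-bound n k a (suc b) c (suc d) _ _ le =
  ≤-+⇒-≤ (ℕtoℚ n) (ℕtoℚ k) (divℕ c (suc d)) (divℕ a (suc b)) (≤-fractions n k a b c d le)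

-- The mean subtree order in terms of missing vertices

sum-filter : ∀ {A : Set} (c : A → Bool) (f : A → ℕ) xs →
             sum (map f (filter (λ x → c x Bool.≟ true) xs)) ≡ sum (map (λ x → 𝟙 (c x) * f x) xs)
sum-filter c f []       = refl
sum-filter c f (x ∷ xs) with c x
... | true  = cong₂ _+_ (sym (*-identityˡ (f x))) (sum-filter c f xs)
... | false = sum-filter c f xs

module _ {n} (G : Graph n) where

  subtreeCount missingTotal : ℕ
  subtreeCount = ∑ˢ n λ S → 𝟙 (connectedInduced G S)
  missingTotal = ∑ˢ n λ S → 𝟙 (connectedInduced G S) * missing S

  length-subtrees : length (subtrees G) ≡ subtreeCount
  length-subtrees = trans (length-filter (connectedInduced G) (allSubsets n)) (∑ˢ-allSubsets n _)

  missing+sizes : missingTotal + sum (map size (subtrees G)) ≡ n * subtreeCount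
  missing+sizes = begin
    missingTotal + sum (map size (subtrees G))
      ≡⟨ cong (missingTotal +_) (trans (sum-filter (connectedInduced G) size (allSubsets n))
           (∑ˢ-allSubsets n λ S → c S * size S)) ⟩
    missingTotal + ∑ˢ n (λ S → c S * size S)
      ≡⟨ ∑ˢ-+ n (λ S → c S * missing S) (λ S → c S * size S) ⟨
    ∑ˢ n (λ S → c S * missing S + c S * size S)
      ≡⟨ ∑ˢ-cong n (λ S → trans (sym (*-distribˡ-+ (c S) (missing S) (size S)))
           (trans (cong (c S *_) (missing+size S)) (*-comm (c S) n))) ⟩
    ∑ˢ n (λ S → n * c S)
      ≡⟨ ∑ˢ-*ˡ n n c ⟩
    n * subtreeCount ∎
    where
    open ≡-Reasoning
    c : VSubset n → ℕ
    c S = 𝟙 (connectedInduced G S)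

  -- By `missing+sizes` the mean is `n` minus the average number of missing vertices; the hypothesis
  -- bounds that average by k + a / b with denominators cleared. Positivity of `b` and of the count
  -- avoids the default value of `divℕ`.
  mean-bound : ∀ k a b → 1 ℕ.≤ b → 1 ℕ.≤ subtreeCount →
    missingTotal * b ℕ.≤ k * (b * subtreeCount) + a * subtreeCount →
    ((ℕtoℚ n - ℕtoℚ k) - divℕ a b) - 0ℚ ℚ.≤ meanSubtreeOrder G
  mean-bound k a b 1≤b 1≤C le rewrite length-subtrees = fraction-bound n k a b Z C 1≤b 1≤C (begin
    n * (b * C)                             ≡⟨ l₁ n b C ⟩
    n * C * b                               ≡⟨ cong (_* b) missing+sizes ⟨
    (missingTotal + Z) * b                  ≡⟨ l₂ missingTotal Z b ⟩
    Z * b + missingTotal * b                ≤⟨ +-monoʳ-≤ (Z * b) le ⟩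
    Z * b + (k * (b * C) + a * C)           ≡⟨ +-assoc (Z * b) (k * (b * C)) (a * C) ⟨
    Z * b + k * (b * C) + a * C             ∎)
    where
    open ≤-Reasoning
    C = subtreeCount
    Z = sum (map size (subtrees G))
    l₁ : ∀ n b c → n * (b * c) ≡ n * c * b
    l₁ = solve-∀
    l₂ : ∀ x z b → (x + z) * b ≡ z * b + x * b
    l₂ = solve-∀

module MeanBound (h r s : ℕ) (r≤8 : r ℕ.≤ 8) (large : s * 1000 + 10000 ℕ.≤ h) (8h²≤2^s : 8 * (h * h) ℕ.≤ 2 ^ s) where
  open FourMiddleLeaves h r s
  open DeficitBound h r s r≤8 large 8h²≤2^s using (rest-bound)
  open ≤-Reasoning

  k A b C : ℕ
  k = suc (suc s)
  A = 81 * (N * N)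
  b = 100 * 2 ^ k
  C = subtreeCount caterpillar

  1≤2^ : ∀ j → 1 ℕ.≤ 2 ^ j
  1≤2^ j = m^n>0 2 j

  2^M≤C : 2 ^ M ℕ.≤ C
  2^M≤C = count-lower (s≤s z≤n)

  2^M≡ : 2 ^ M ≡ 2 ^ k * 2 ^ k
  2^M≡ = trans (cong (2 ^_) (l s)) (^-distribˡ-+-* 2 k k)
    where
    l : ∀ s → 4 + s * 2 ≡ (2 + s) + (2 + s)
    l = solve-∀

  missing≤′ : missingTotal caterpillar ℕ.≤ k * 2 ^ M + rest
  missing≤′ = *-cancelˡ-≤ 2 (≤-trans missing-bound (≤-reflexive (l s (2 ^ M) rest)))
    where
    l : ∀ s p x → (4 + s * 2) * p + 2 * x ≡ 2 * ((2 + s) * p + x)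
    l = solve-∀

  -- Both losses are first computed relative to `2 ^ M`, the number of subtrees containing the
  -- spine; replacing it by the larger `C` only weakens the bound. The second loss fits because
  -- `4 * 2 ^ s` is `2 ^ k` and `2 ^ M` is its square.
  deficit : missingTotal caterpillar * b ℕ.≤ k * (b * C) + A * C
  deficit = begin
    missingTotal caterpillar * b                  ≤⟨ *-monoˡ-≤ b missing≤′ ⟩
    (k * 2 ^ M + rest) * b                        ≡⟨ l₁ k (2 ^ M) rest (2 ^ k) ⟩
    k * (b * 2 ^ M) + rest * 100 * 2 ^ k          ≤⟨ +-monoʳ-≤ (k * (b * 2 ^ M)) (*-monoˡ-≤ (2 ^ k) rest-bound) ⟩
    k * (b * 2 ^ M) + A * (4 * 2 ^ s) * 2 ^ k     ≡⟨ cong (k * (b * 2 ^ M) +_) (trans (l₂ A (2 ^ s) (2 ^ k)) (cong (A *_) (sym 2^M≡))) ⟩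
    k * (b * 2 ^ M) + A * 2 ^ M                   ≤⟨ +-mono-≤ (*-monoʳ-≤ k (*-monoʳ-≤ b 2^M≤C)) (*-monoʳ-≤ A 2^M≤C) ⟩
    k * (b * C) + A * C                           ∎
    where
    l₁ : ∀ k p x q → (k * p + x) * (100 * q) ≡ k * (100 * q * p) + x * 100 * q
    l₁ = solve-∀
    l₂ : ∀ a p q → a * (4 * p) * q ≡ a * (2 * (2 * p) * q)
    l₂ = solve-∀

  mean≥ : ((ℕtoℚ N - ℕtoℚ k) - divℕ A b) - 0ℚ ℚ.≤ meanSubtreeOrder caterpillar
  mean≥ = mean-bound caterpillar k A b (*-mono-≤ (≤ᵇ⇒≤ 1 100 _) (1≤2^ k)) (≤-trans (1≤2^ M) 2^M≤C) deficit

-- Choice of the parameters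

-- From 100 on, the square grows by a factor below 2 at each step; the identity `l` exhibits the
-- slack.
square≤2^ : ∀ c → 100 * 100 * c ℕ.≤ 2 ^ 100 → ∀ k → 100 ℕ.≤ k → k * k * c ℕ.≤ 2 ^ k
square≤2^ c base k 100≤k = subst (λ k → k * k * c ℕ.≤ 2 ^ k) (m∸n+n≡m 100≤k) (go (k ∸ 100))
  where
  l : ∀ j c → (1 + (j + 100)) * (1 + (j + 100)) * c + (j * j + j * 198 + 9799) * c
          ≡ 2 * ((j + 100) * (j + 100) * c)
  l = solve-∀
  go : ∀ j → (j + 100) * (j + 100) * c ℕ.≤ 2 ^ (j + 100)
  go zero    = base
  go (suc j) = ≤-trans (≤-trans (m≤m+n ((1 + (j + 100)) * (1 + (j + 100)) * c) ((j * j + j * 198 + 9799) * c))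
    (≤-reflexive (l j c))) (*-monoʳ-≤ 2 (go j))

module Parameters (t n k : ℕ) (t-large : 100 * 2 ^ 100 ℕ.≤ 81 * (t * t)) (t≤n : t ℕ.≤ n)
  (lower : 100 * 2 ^ k ℕ.≤ 81 * (n * n)) (upper : 81 * (n * n) ℕ.< 100 * 2 ^ suc k) where

  100≤k : 100 ℕ.≤ k
  100≤k = ≮⇒≥ λ k<100 → <⇒≱ upper (begin
    100 * 2 ^ suc k                      ≤⟨ *-monoʳ-≤ 100 (^-monoʳ-≤ 2 k<100) ⟩
    100 * 2 ^ 100                        ≤⟨ t-large ⟩
    81 * (t * t)                         ≤⟨ *-monoʳ-≤ 81 (*-mono-≤ t≤n t≤n) ⟩
    81 * (n * n)                         ∎)
    where open ≤-Reasoning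

  -- By `lower`, n grows at least like 2^(k/2) and so beats every multiple of k. The factor 10000
  -- leaves room for `large`, where `h` is only about n / 9.
  k*10000≤n : k * 10000 ℕ.≤ n
  k*10000≤n = ≮⇒≥ λ n<k → <⇒≱ (≤ᵇ⇒≤ 82 100 _) (*-cancelʳ-≤ 100 81 (2 ^ k) {{m^n≢0 2 k}} (begin
    100 * 2 ^ k                          ≤⟨ lower ⟩
    81 * (n * n)                         ≤⟨ *-monoʳ-≤ 81 (*-mono-≤ (<⇒≤ n<k) (<⇒≤ n<k)) ⟩
    81 * (k * 10000 * (k * 10000))       ≡⟨ cong (81 *_) (l k) ⟩
    81 * (k * k * 100000000)             ≤⟨ *-monoʳ-≤ 81 (square≤2^ 100000000 (≤ᵇ⇒≤ (100 * 100 * 100000000) (2 ^ 100) _) k 100≤k) ⟩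
    81 * 2 ^ k                           ∎))
    where
    open ≤-Reasoning
    l : ∀ k → k * 10000 * (k * 10000) ≡ k * k * 100000000
    l = solve-∀

  -- `q` is the label of the last spine vertex: `n` minus the `4 + s * 2` leaves and minus one,
  -- since the spine is numbered from 0.
  s q r h : ℕ
  s = k ∸ 2
  q = n ∸ suc (4 + s * 2)
  r = q ℕ.% 9
  h = q ℕ./ 9

  k≡ : s + 2 ≡ k
  k≡ = m∸n+n≡m (≤-trans (≤ᵇ⇒≤ 2 100 _) 100≤k)

  98≤s : 98 ℕ.≤ s
  98≤s = ∸-monoˡ-≤ 2 100≤k

  big : s * 10000 + 20000 ℕ.≤ n
  big = ≤-trans (≤-reflexive (trans (l s) (cong (_* 10000) k≡))) k*10000≤n
    where
    l : ∀ s → s * 10000 + 20000 ≡ (s + 2) * 10000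
    l = solve-∀

  q≡ : h * 9 + r ≡ q
  q≡ = trans (+-comm (h * 9) r) (sym (m≡m%n+[m/n]*n q 9))

  r≤8 : r ℕ.≤ 8
  r≤8 = s≤s⁻¹ (m%n<n q 9)

  q+≡ : q + suc (4 + s * 2) ≡ n
  q+≡ = m∸n+n≡m (≤-trans (≤-reflexive (+-comm 5 (s * 2)))
    (≤-trans (+-mono-≤ (*-monoʳ-≤ s (≤ᵇ⇒≤ 2 10000 _)) (≤ᵇ⇒≤ 5 20000 _)) big))

  n≡ : suc (h * 9 + r) + (4 + s * 2) ≡ n
  n≡ = trans (cong (λ z → suc z + (4 + s * 2)) q≡) (trans (sym (+-suc q (4 + s * 2))) q+≡)

  large : s * 1000 + 10000 ℕ.≤ h
  large = ≮⇒≥ λ h<X → <⇒≱ (n< h<X) big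
    where
    open ≤-Reasoning
    l₁ : ∀ h r s → 2 + (h * 9 + r) + (4 + s * 2) ≡ h * 9 + r + (s * 2 + 6)
    l₁ = solve-∀
    l₂ : ∀ h s → h * 9 + 8 + (s * 2 + 6) ≡ (1 + h) * 9 + (s * 2 + 5)
    l₂ = solve-∀
    l₃ : ∀ s → (s * 1000 + 10000) * 9 + (s * 2 + 5) ≡ s * 9002 + 90005
    l₃ = solve-∀
    l₄ : ∀ s → s * 9002 + s * 998 ≡ s * 10000
    l₄ = solve-∀
    n< : h ℕ.< s * 1000 + 10000 → n ℕ.< s * 10000 + 20000
    n< h<X = begin
      suc n                                       ≡⟨ cong suc n≡ ⟨
      suc (suc (h * 9 + r)) + (4 + s * 2)         ≡⟨ l₁ h r s ⟩
      h * 9 + r + (s * 2 + 6)                     ≤⟨ +-monoˡ-≤ (s * 2 + 6) (+-monoʳ-≤ (h * 9) r≤8) ⟩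
      h * 9 + 8 + (s * 2 + 6)                     ≡⟨ l₂ h s ⟩
      suc h * 9 + (s * 2 + 5)                     ≤⟨ +-monoˡ-≤ (s * 2 + 5) (*-monoˡ-≤ 9 h<X) ⟩
      (s * 1000 + 10000) * 9 + (s * 2 + 5)        ≡⟨ l₃ s ⟩
      -- The constant is absorbed through `98 ≤ s`, as 98 * 998 = 97804.
      s * 9002 + 90005                            ≤⟨ +-monoʳ-≤ (s * 9002) (≤-trans (≤ᵇ⇒≤ 90005 (98 * 998) _) (*-monoˡ-≤ 998 98≤s)) ⟩
      s * 9002 + s * 998                          ≡⟨ l₄ s ⟩
      s * 10000                                   ≤⟨ m≤m+n (s * 10000) 20000 ⟩
      s * 10000 + 20000                           ∎

  -- Since `h * 9 ≤ n`, the hypothesis `upper` gives 6561 h² ≤ 200 * 2^k = 800 * 2^s, and 800 * 8 =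
  -- 6400 is below 6561.
  8h²≤2^s : 8 * (h * h) ℕ.≤ 2 ^ s
  8h²≤2^s = *-cancelˡ-≤ 800 (begin
    800 * (8 * (h * h))          ≡⟨ l₁ h ⟩
    h * h * 6400                 ≤⟨ *-monoʳ-≤ (h * h) (≤ᵇ⇒≤ 6400 6561 _) ⟩
    h * h * 6561                 ≡⟨ l₂ h ⟩
    81 * (h * 9 * (h * 9))       ≤⟨ *-monoʳ-≤ 81 (*-mono-≤ 9h≤n 9h≤n) ⟩
    81 * (n * n)                 ≤⟨ <⇒≤ upper ⟩
    100 * (2 * 2 ^ k)            ≡⟨ cong (λ k → 100 * (2 * 2 ^ k)) (trans (+-comm 2 s) k≡) ⟨
    100 * (2 * (2 * (2 * 2 ^ s)))  ≡⟨ l₃ (2 ^ s) ⟩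
    800 * 2 ^ s                  ∎)
    where
    open ≤-Reasoning
    9h≤n : h * 9 ℕ.≤ n
    9h≤n = ≤-trans (m≤m+n (h * 9) r) (≤-trans (≤-reflexive q≡) (m∸n≤m n (suc (4 + s * 2))))
    l₁ : ∀ h → 800 * (8 * (h * h)) ≡ h * h * 6400
    l₁ = solve-∀
    l₂ : ∀ h → h * h * 6561 ≡ 81 * (h * 9 * (h * 9))
    l₂ = solve-∀
    l₃ : ∀ p → 100 * (2 * (2 * (2 * p))) ≡ 800 * p
    l₃ = solve-∀

  good-tree : ∃[ T ] (IsTree {n} T ×
    ((ℕtoℚ n - ℕtoℚ k) - divℕ (81 * (n * n)) (100 * 2 ^ k)) - 0ℚ ℚ.≤ meanSubtreeOrder T)
  good-tree = subst₂ (λ n k → ∃[ T ] (IsTree {n} T ×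
      ((ℕtoℚ n - ℕtoℚ k) - divℕ (81 * (n * n)) (100 * 2 ^ k)) - 0ℚ ℚ.≤ meanSubtreeOrder T))
    n≡ (trans (+-comm 2 s) k≡)
    (caterpillar , caterpillar-tree (s≤s z≤n) , MeanBound.mean≥ h r s r≤8 large 8h²≤2^s)
    where open FourMiddleLeaves h r s using (caterpillar; caterpillar-tree)

theorem5p1 : Σ (ℕ → ℚ) λ ε →
    (∀ (δ : ℚ) → 0ℚ < δ → ∃[ N ] (∀ n → N Data.Nat.≤ n → ∣ ε n ∣ ≤ δ))
    × ∃[ N ] (∀ n → N Data.Nat.≤ n →
    ∀ (k : ℕ) → 100 * 2 ^ k Data.Nat.≤ 81 * (n * n) → 81 * (n * n) Data.Nat.< 100 * 2 ^ suc k →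
    ∃[ T ] (IsTree {n} T ×
    (((ℕtoℚ n - ℕtoℚ k) - divℕ (81 * (n * n)) (100 * 2 ^ k)) - ε n ≤ meanSubtreeOrder T)))
-- The threshold `2 ^ 52` makes 81 n² at least 81 * 2^104, which exceeds 100 * 2^100 and so forces
-- `100 ≤ k`.
theorem5p1 = (λ _ → 0ℚ) , (λ δ 0<δ → 0 , λ _ _ → ℚ.<⇒≤ 0<δ) , 2 ^ 52 , λ n 2^52≤n k lower upper →
  let open Parameters (2 ^ 52) n k (≤ᵇ⇒≤ (100 * 2 ^ 100) (81 * (2 ^ 52 * 2 ^ 52)) _) 2^52≤n lower upper
  in good-tree
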